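{- For each positive integer $n$ there exists a set $A_n\subset\{0,1,2\}^n\subset\mathbb{Z}^n$ such that, as $n\to\infty$, $d_d(A_n)=n\log_4 n\,(1+o(1))$ and \[ \frac{d_s(A_n)}{d_d^-(A_n)}\leq\frac{1}{\log_4 d_d(A_n)}\big(1+o(1)\big). \]
   Context: Sets are viewed as additive sets in the abelian group $\mathbb{Z}^n$. A set $D$ is dissociated if its subset sums are pairwise distinct, equivalently the only combination $\sum_{x\in D}\varepsilon_x x$ with $\varepsilon_x\in\{ -1,0,1\}$ equal to $0$ is the trivial one. $D\subset A$ is a maximal dissociated subset of $A$ if no dissociated $D'\subset A$ strictly contains $D$. $d_d(A)=\max\{|D|:D\subset A\text{ dissociated}\}$ and $d_d^-(A)=\min\{|D|: D\subset A\text{ maximal dissociated}\}$. The 1-span $\langle S\rangle$ of $S$ is the set of all sums $\sum_{s\in S}\varepsilon_s s$ with $\varepsilon_s\in\{ -1,0,1\}$, and $d_s(A)=\min\{|S|: S\subset A,\ \langle S\rangle\supset A\}$. -}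

module Defs where

open import Data.Nat using (ℕ; zero; suc; _≤_; _<_; _^_) renaming (_*_ to _*ℕ_; _+_ to _+ℕ_)
open import Data.Nat using (_∸_)
open import Data.Integer using (ℤ; +_; -_; _+_)
open import Data.List using (List; []; _∷_; length)
open import Data.List.Relation.Unary.Unique.Propositional using (Unique)
open import Data.List.Relation.Unary.All as LAll using ()
open import Data.List.Relation.Binary.Subset.Propositional using (_⊆_)
open import Data.List.Membership.Propositional using (_∈_)
open import Data.Vec as Vec using (Vec; []; _∷_; replicate; zipWith; map)
open import Data.Vec.Relation.Unary.All as VAll using ()
open import Data.Product using (Σ; ∃; _×_; _,_)
open import Data.Sum using (_⊎_)
open import Relation.Binary.PropositionalEquality using (_≡_)

Point : ℕ → Set
Point n = Vec ℤ n

FinSet : ℕ → Set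
FinSet n = Σ (List (Point n)) Unique

elems : ∀ {n} → FinSet n → List (Point n)
elems (xs , _) = xs

data Sign : Set where
  neg zer pos : Sign

signℤ : Sign → ℤ
signℤ neg = - (+ 1)
signℤ zer = + 0
signℤ pos = + 1

scale : ∀ {n} → Sign → Point n → Point n
scale s = map (λ z → Data.Integer._*_ (signℤ s) z)

zeroPt : ∀ {n} → Point n
zeroPt = replicate _ (+ 0)

lincomb : ∀ {n} (D : List (Point n)) → Vec Sign (length D) → Point n
lincomb [] [] = zeroPt
lincomb (x ∷ D) (s ∷ ss) = zipWith _+_ (scale s x) (lincomb D ss)

Dissociated : ∀ {n} → FinSet n → Set
Dissociated (D , _) = ∀ (ε : Vec Sign (length D)) → lincomb D ε ≡ zeroPt → ε ≡ replicate _ zer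

_⊆ₛ_ : ∀ {n} → FinSet n → FinSet n → Set
D ⊆ₛ A = elems D ⊆ elems A

∣_∣ : ∀ {n} → FinSet n → ℕ
∣ D ∣ = length (elems D)

MaximalDissociated : ∀ {n} → FinSet n → FinSet n → Set
MaximalDissociated A D =
  D ⊆ₛ A × Dissociated D ×
  (∀ (D' : FinSet _) → D' ⊆ₛ A → Dissociated D' → D ⊆ₛ D' → D' ⊆ₛ D)

InSpan : ∀ {n} → FinSet n → Point n → Set
InSpan (S , _) x = ∃ λ (ε : Vec Sign (length S)) → lincomb S ε ≡ x

IsDd : ∀ {n} → FinSet n → ℕ → Set
IsDd A k =
  (∃ λ D → D ⊆ₛ A × Dissociated D × ∣ D ∣ ≡ k) ×
  (∀ D → D ⊆ₛ A → Dissociated D → ∣ D ∣ ≤ k)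

IsDdMinus : ∀ {n} → FinSet n → ℕ → Set
IsDdMinus A k =
  (∃ λ D → MaximalDissociated A D × ∣ D ∣ ≡ k) ×
  (∀ D → MaximalDissociated A D → k ≤ ∣ D ∣)

Spanning : ∀ {n} → FinSet n → FinSet n → Set
Spanning A S = S ⊆ₛ A × (∀ x → x ∈ elems A → InSpan S x)

IsDs : ∀ {n} → FinSet n → ℕ → Set
IsDs A k =
  (∃ λ S → Spanning A S × ∣ S ∣ ≡ k) ×
  (∀ S → Spanning A S → k ≤ ∣ S ∣)

Digit : ℤ → Set
Digit z = z ≡ + 0 ⊎ z ≡ + 1 ⊎ z ≡ + 2

In012 : ∀ {n} → FinSet n → Set
In012 A = LAll.All (VAll.All Digit) (elems A)

-- Asymptotic conditions, for rational ε = p/q with 0 < p < q, cleared of logarithms: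
--  (1-ε) n log₄ n ≤ d  ⇔  n^((q-p) n) ≤ 4^(q d)
--  d ≤ (1+ε) n log₄ n  ⇔  4^(q d) ≤ n^((q+p) n)
--  ds · log₄ D ≤ (1+ε) dm  ⇔  D^(q ds) ≤ 4^((q+p) dm)
EventuallyWithin : (ℕ → ℕ) → Set
EventuallyWithin dd =
  ∀ p q → 0 < p → p < q → ∃ λ N → ∀ n → N ≤ n →
    (n ^ ((q ∸ p) *ℕ n) ≤ 4 ^ (q *ℕ dd n)) × (4 ^ (q *ℕ dd n) ≤ n ^ ((q +ℕ p) *ℕ n))

EventuallyRatio : (ℕ → ℕ) → (ℕ → ℕ) → (ℕ → ℕ) → Set
EventuallyRatio dd dm ds =
  ∀ p q → 0 < p → p < q → ∃ λ N → ∀ n → N ≤ n →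
    dd n ^ (q *ℕ ds n) ≤ 4 ^ ((q +ℕ p) *ℕ dm n)

{-# OPTIONS --safe #-}

-- Let D ⊂ {0,1}ⁿ be dissociated of size c ~ n log₄ n, and put A = {v, e₁, …, eₙ} ∪ 2D with v = (1, …, 1).
-- Modulo 2, a {-1,0,1}-relation on A uses either all of the core v, e₁, …, eₙ or none of it, and
-- in the latter case it is a relation on 2D, hence trivial.  So A ∖ {a} is dissociated for each a in
-- the core, while v = Σ eᵢ forces every dissociated subset to miss some core element.  All maximal
-- dissociated subsets therefore have exactly |A| − 1 = n + c elements.  On the other hand the core
-- spans A, because 2d = v + Σ (2dᵢ − 1) eᵢ, so d_s(A) ≤ n + 1.
--
-- D is built by doubling (Lindström, Cantor–Mills).  Write its elements as (1, x).  If the family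
-- of the x detects signs, so does the one consisting of (x, 1, x), (x, 0, 1 − x) and (eᵢ, 1, 0):
-- the constant and middle coordinates show that the second signs sum to 0, then the outer ones give
-- 2a + z = 0 for the third signs z, hence z = 0 and both halves vanish.
module Submission where

open import Defs
open import Data.Nat as ℕ using (ℕ; zero; suc; _≤_; _<_; s≤s; z≤n)
open import Data.Nat.DivMod using (_/_; m≡m%n+[m/n]*n; m%n<n; m/n*n≤m; /-monoˡ-≤; m*n/n≡m)
open import Data.Nat.Induction using (<-rec)
import Data.Nat.Properties as ℕₚ
import Data.Nat.Tactic.RingSolver as ℕSolver
open import Data.Integer as ℤ using (ℤ; +_; 0ℤ; 1ℤ)
import Data.Integer.Properties as ℤₚ
open import Data.Integer.Tactic.RingSolver using (solve-∀)
open import Data.Empty using (⊥; ⊥-elim)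
open import Data.Fin using (Fin; zero; suc; _↑ˡ_; _↑ʳ_)
import Data.Fin.Properties as Finₚ
open import Data.List using (List; []; _∷_; _++_; length; map; allFin; tabulate)
import Data.List.Properties as Listₚ
import Data.List.Membership.DecPropositional as DecMembership
open import Data.List.Membership.Propositional using (_∈_; _∉_; find)
open import Data.List.Membership.Propositional.Properties
  using (∈-++⁺ˡ; ∈-++⁺ʳ; ∈-++⁻; ∈-map⁺; ∈-map⁻; ∈-allFin; ∈-∃++)
open import Data.List.Relation.Binary.Permutation.Propositional as Perm using (_↭_; ↭-sym; ↭-trans)
import Data.List.Relation.Binary.Permutation.Propositional.Properties as Permₚ
import Data.List.Relation.Binary.Permutation.Setoid.Properties as PermSetoidₚ
open import Data.List.Relation.Binary.Subset.Propositional using (_⊆_)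
open import Data.List.Relation.Unary.All as All using (All; []; _∷_)
import Data.List.Relation.Unary.All.Properties as Allₚ
open import Data.List.Relation.Unary.AllPairs using ([]; _∷_)
open import Data.List.Relation.Unary.Any as Any using (Any; here; there)
open import Data.List.Relation.Unary.Unique.Propositional using (Unique)
import Data.List.Relation.Unary.Unique.DecPropositional as DecUnique
import Data.List.Relation.Unary.Unique.Propositional.Properties as Uniqueₚ
open import Data.Product using (Σ; ∃; _×_; _,_; proj₁; proj₂)
open import Data.Sum using (_⊎_; inj₁; inj₂)
open import Data.Vec as Vec using (Vec; []; _∷_; lookup; replicate)
import Data.Vec.Properties as Vecₚ
import Data.Vec.Relation.Unary.All as VecAll
import Data.Vec.Relation.Unary.All.Properties as VecAllₚ
open import Function using (_∘_; id)
open import Relation.Binary.PropositionalEquality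
open import Relation.Nullary using (¬_; Dec; yes; no; contradiction)
open import Relation.Nullary.Decidable using (map′; _×-dec_; _⊎-dec_)

private variable
  X Y : Set
  n r : ℕ

_≟ₚ_ : (x y : Point n) → Dec (x ≡ y)
_≟ₚ_ = Vecₚ.≡-dec ℤ._≟_

-- Signed sums

-- Signs and summands are both functions on the index type. One notion thus covers genuine
-- coordinates and the constant coordinate `λ _ → 1ℤ`, and reindexing along a map is mere
-- precomposition.
wsum : (X → Sign) → (X → ℤ) → List X → ℤ
wsum σ φ []       = 0ℤ
wsum σ φ (x ∷ xs) = signℤ (σ x) ℤ.* φ x ℤ.+ wsum σ φ xs

wsum-++ : ∀ (σ : X → Sign) φ xs ys → wsum σ φ (xs ++ ys) ≡ wsum σ φ xs ℤ.+ wsum σ φ ys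
wsum-++ σ φ []       ys = sym (ℤₚ.+-identityˡ _)
wsum-++ σ φ (x ∷ xs) ys =
  trans (cong (λ z → signℤ (σ x) ℤ.* φ x ℤ.+ z) (wsum-++ σ φ xs ys))
        (sym (ℤₚ.+-assoc (signℤ (σ x) ℤ.* φ x) _ _))

wsum-map : ∀ (σ : Y → Sign) φ (f : X → Y) xs → wsum σ φ (map f xs) ≡ wsum (σ ∘ f) (φ ∘ f) xs
wsum-map σ φ f []       = refl
wsum-map σ φ f (x ∷ xs) = cong (λ z → signℤ (σ (f x)) ℤ.* φ (f x) ℤ.+ z) (wsum-map σ φ f xs)

wsum-cong : ∀ (σ : X → Sign) {φ ψ} → φ ≗ ψ → ∀ xs → wsum σ φ xs ≡ wsum σ ψ xs
wsum-cong σ e []       = refl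
wsum-cong σ e (x ∷ xs) = cong₂ ℤ._+_ (cong (signℤ (σ x) ℤ.*_) (e x)) (wsum-cong σ e xs)

wsum-const0 : ∀ (σ : X → Sign) xs → wsum σ (λ _ → 0ℤ) xs ≡ 0ℤ
wsum-const0 σ []       = refl
wsum-const0 σ (x ∷ xs) = cong₂ ℤ._+_ (ℤₚ.*-zeroʳ (signℤ (σ x))) (wsum-const0 σ xs)

wsum-off : ∀ (σ : X → Sign) φ xs → (∀ {x} → x ∈ xs → σ x ≡ zer) → wsum σ φ xs ≡ 0ℤ
wsum-off σ φ []       off = refl
wsum-off σ φ (x ∷ xs) off rewrite off (here refl) =
  trans (ℤₚ.+-identityˡ _) (wsum-off σ φ xs (off ∘ there))

wsum-minus : ∀ (σ : X → Sign) φ ψ xs →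
  wsum σ (λ x → φ x ℤ.- ψ x) xs ≡ wsum σ φ xs ℤ.- wsum σ ψ xs
wsum-minus σ φ ψ []       = refl
wsum-minus σ φ ψ (x ∷ xs) =
  trans (cong (λ z → signℤ (σ x) ℤ.* (φ x ℤ.- ψ x) ℤ.+ z) (wsum-minus σ φ ψ xs))
        (step (signℤ (σ x)) (φ x) (ψ x) (wsum σ φ xs) (wsum σ ψ xs))
  where
  step : ∀ s a b c d →
    s ℤ.* (a ℤ.- b) ℤ.+ (c ℤ.- d) ≡ (s ℤ.* a ℤ.+ c) ℤ.- (s ℤ.* b ℤ.+ d)
  step = solve-∀

wsum-double : ∀ (σ : X → Sign) φ xs →
  wsum σ (λ x → + 2 ℤ.* φ x) xs ≡ + 2 ℤ.* wsum σ φ xs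
wsum-double σ φ []       = refl
wsum-double σ φ (x ∷ xs) =
  trans (cong (λ z → signℤ (σ x) ℤ.* (+ 2 ℤ.* φ x) ℤ.+ z) (wsum-double σ φ xs))
        (step (signℤ (σ x)) (φ x) (wsum σ φ xs))
  where
  step : ∀ s a c → s ℤ.* (+ 2 ℤ.* a) ℤ.+ + 2 ℤ.* c ≡ + 2 ℤ.* (s ℤ.* a ℤ.+ c)
  step = solve-∀

wsum-↭ : ∀ (σ : X → Sign) φ {xs ys} → xs ↭ ys → wsum σ φ xs ≡ wsum σ φ ys
wsum-↭ σ φ Perm.refl         = refl
wsum-↭ σ φ (Perm.prep x p)   = cong (λ z → signℤ (σ x) ℤ.* φ x ℤ.+ z) (wsum-↭ σ φ p)
wsum-↭ σ φ (Perm.swap {xs} {ys} x y p) =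
  trans (cong (λ z → signℤ (σ x) ℤ.* φ x ℤ.+ (signℤ (σ y) ℤ.* φ y ℤ.+ z)) (wsum-↭ σ φ p))
        (step (signℤ (σ x) ℤ.* φ x) (signℤ (σ y) ℤ.* φ y) (wsum σ φ ys))
  where
  step : ∀ a b c → a ℤ.+ (b ℤ.+ c) ≡ b ℤ.+ (a ℤ.+ c)
  step = solve-∀
wsum-↭ σ φ (Perm.trans p q)  = trans (wsum-↭ σ φ p) (wsum-↭ σ φ q)

wsum-tabulate-off : ∀ (σ : X → Sign) φ {n} (f : Fin n → X) →
  (∀ i → φ (f i) ≡ 0ℤ) → wsum σ φ (tabulate f) ≡ 0ℤ
wsum-tabulate-off σ φ {zero}  f off = refl
wsum-tabulate-off σ φ {suc n} f off =
  cong₂ ℤ._+_ (trans (cong (signℤ (σ (f zero)) ℤ.*_) (off zero)) (ℤₚ.*-zeroʳ (signℤ (σ (f zero)))))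
              (wsum-tabulate-off σ φ (f ∘ suc) (off ∘ suc))

-- Serves for unit vectors: a single term survives, so each coordinate of their signed sum reads off
-- one sign.
wsum-tabulate-δ : ∀ (σ : X → Sign) φ {n} (f : Fin n → X) j →
  φ (f j) ≡ 1ℤ → (∀ i → i ≢ j → φ (f i) ≡ 0ℤ) →
  wsum σ φ (tabulate f) ≡ signℤ (σ (f j))
wsum-tabulate-δ σ φ f zero on off =
  trans (cong₂ ℤ._+_ (trans (cong (signℤ (σ (f zero)) ℤ.*_) on) (ℤₚ.*-identityʳ (signℤ (σ (f zero)))))
                     (wsum-tabulate-off σ φ (f ∘ suc) (λ i → off (suc i) λ ())))
        (ℤₚ.+-identityʳ (signℤ (σ (f zero))))
wsum-tabulate-δ σ φ f (suc j) on off =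
  trans (cong₂ ℤ._+_ (trans (cong (signℤ (σ (f zero)) ℤ.*_) (off zero λ ())) (ℤₚ.*-zeroʳ (signℤ (σ (f zero)))))
                     (wsum-tabulate-δ σ φ (f ∘ suc) j on (λ i i≢j → off (suc i) (i≢j ∘ Finₚ.suc-injective))))
        (ℤₚ.+-identityˡ _)

-- Lists without repetition

Unique-++⇒disjoint : ∀ (xs : List X) {ys x} → Unique (xs ++ ys) → x ∈ xs → x ∉ ys
Unique-++⇒disjoint (x ∷ xs) (x# ∷ u) (here refl) q = All.lookup x# (∈-++⁺ʳ xs q) refl
Unique-++⇒disjoint (x ∷ xs) (x# ∷ u) (there p)   q = Unique-++⇒disjoint xs u p q

Unique-resp-↭ : {xs ys : List X} → xs ↭ ys → Unique xs → Unique ys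
Unique-resp-↭ {X} p = PermSetoidₚ.Unique-resp-↭ (setoid X) (Perm.↭⇒↭ₛ p)

-- Each element of `xs` is located in `ys`, moved to the front and removed; as `xs` has no
-- repetition, its other elements survive the removal. The remainder `zs` lets a signed sum over
-- `ys` be split at `xs`.
⊆⇒↭-++ : {xs ys : List X} → Unique xs → xs ⊆ ys → ∃ λ zs → ys ↭ xs ++ zs
⊆⇒↭-++ {xs = []}     {ys} u        sub = ys , Perm.refl
⊆⇒↭-++ {X} {xs = x ∷ xs} {ys} (x# ∷ u) sub with ∈-∃++ (sub (here refl))
... | as , bs , refl = zs , ↭-trans (Permₚ.shift x as bs) (Perm.prep x p)
  where
  sub′ : xs ⊆ as ++ bs
  sub′ {y} y∈ with Permₚ.∈-resp-↭ (Permₚ.shift x as bs) (sub (there y∈))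
  ... | here refl = ⊥-elim (All.lookup x# y∈ refl)
  ... | there q   = q
  rec = ⊆⇒↭-++ u sub′
  zs = proj₁ rec
  p = proj₂ rec

⊆⇒length≤ : {xs ys : List X} → Unique xs → xs ⊆ ys → length xs ≤ length ys
⊆⇒length≤ {xs = xs} u sub with ⊆⇒↭-++ u sub
... | zs , p = subst (length xs ≤_) (sym (Permₚ.↭-length p)) (Listₚ.length-++-≤ˡ xs)

∈⇒↭-∷ : {x : X} {ys : List X} → x ∈ ys → ∃ λ zs → ys ↭ x ∷ zs
∈⇒↭-∷ {x = x} x∈ with ∈-∃++ x∈
... | as , bs , refl = as ++ bs , Permₚ.shift x as bs

-- Dissociation through sign functions

coord : Fin n → Point n → ℤ
coord i x = lookup x i

-- Signs are attached to points rather than to list positions, so that they are insensitive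
-- to order and can be extended by zer; on lists with repetitions this differs from Dissociated.
Independent : List (Point n) → Set
Independent {n} xs = ∀ (σ : Point n → Sign) →
  (∀ i → wsum σ (coord i) xs ≡ 0ℤ) → ∀ {x} → x ∈ xs → σ x ≡ zer

signs : (Point n → Sign) → (xs : List (Point n)) → Vec Sign (length xs)
signs σ xs = Vec.map σ (Vec.fromList xs)

lookup-lincomb : ∀ (σ : Point n → Sign) xs i →
  lookup (lincomb xs (signs σ xs)) i ≡ wsum σ (coord i) xs
lookup-lincomb σ []       i = Vecₚ.lookup-replicate i 0ℤ
lookup-lincomb σ (x ∷ xs) i =
  trans (Vecₚ.lookup-zipWith ℤ._+_ i (scale (σ x) x) _)
        (cong₂ ℤ._+_ (Vecₚ.lookup-map i _ x) (lookup-lincomb σ xs i))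

lookup⇒≡ : {x y : Point n} → (∀ i → lookup x i ≡ lookup y i) → x ≡ y
lookup⇒≡ {x = x} {y} e =
  trans (sym (Vecₚ.tabulate∘lookup x)) (trans (Vecₚ.tabulate-cong e) (Vecₚ.tabulate∘lookup y))

-- A right inverse of `signs` on lists without repetition: the first occurrence of a point decides.
-- The default `zer` off the list is what later allows a relation to be extended to a larger set.
signAt : (xs : List (Point n)) → Vec Sign (length xs) → Point n → Sign
signAt []       []      y = zer
signAt (x ∷ xs) (s ∷ ε) y with y ≟ₚ x
... | yes _ = s
... | no  _ = signAt xs ε y

signAt-∉ : ∀ (xs : List (Point n)) ε {y} → y ∉ xs → signAt xs ε y ≡ zer
signAt-∉ []       []      y∉ = refl
signAt-∉ (x ∷ xs) (s ∷ ε) {y} y∉ with y ≟ₚ x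
... | yes y≡x = ⊥-elim (y∉ (here y≡x))
... | no  _   = signAt-∉ xs ε (y∉ ∘ there)

signs-cong : ∀ {σ τ : Point n → Sign} xs → (∀ {x} → x ∈ xs → σ x ≡ τ x) → signs σ xs ≡ signs τ xs
signs-cong []       e = refl
signs-cong (x ∷ xs) e = cong₂ _∷_ (e (here refl)) (signs-cong xs (e ∘ there))

signs-zer : ∀ {σ : Point n → Sign} xs → signs σ xs ≡ replicate _ zer → ∀ {x} → x ∈ xs → σ x ≡ zer
signs-zer (x ∷ xs) e (here refl) = Vecₚ.∷-injectiveˡ e
signs-zer (x ∷ xs) e (there p)   = signs-zer xs (Vecₚ.∷-injectiveʳ e) p

signs∘signAt : ∀ (xs : List (Point n)) ε → Unique xs → signs (signAt xs ε) xs ≡ ε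
signs∘signAt []       []      u = refl
signs∘signAt (x ∷ xs) (s ∷ ε) (x# ∷ u) = cong₂ _∷_ head (trans (signs-cong xs tail) (signs∘signAt xs ε u))
  where
  head : signAt (x ∷ xs) (s ∷ ε) x ≡ s
  head with x ≟ₚ x
  ... | yes _ = refl
  ... | no ¬p = ⊥-elim (¬p refl)
  tail : ∀ {y} → y ∈ xs → signAt (x ∷ xs) (s ∷ ε) y ≡ signAt xs ε y
  tail {y} y∈ with y ≟ₚ x
  ... | yes refl = ⊥-elim (All.lookup x# y∈ refl)
  ... | no _     = refl

replicate-signs : ∀ {σ : Point n → Sign} xs → (∀ {x} → x ∈ xs → σ x ≡ zer) → signs σ xs ≡ replicate _ zer
replicate-signs []       e = refl
replicate-signs (x ∷ xs) e = cong₂ _∷_ (e (here refl)) (replicate-signs xs (e ∘ there))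

-- The sign function to be tested is `signAt xs ε`, which vanishes off `xs`; this is passed on as an
-- extra assumption on `σ`.
signsVanish⇒Dissociated : ∀ (xs : List (Point n)) (u : Unique xs) →
  (∀ (σ : Point n → Sign) → (∀ {y} → y ∉ xs → σ y ≡ zer) →
     (∀ i → wsum σ (coord i) xs ≡ 0ℤ) → ∀ {x} → x ∈ xs → σ x ≡ zer) →
  Dissociated (xs , u)
signsVanish⇒Dissociated xs u ind ε e =
  trans (sym ε≡) (replicate-signs xs (ind σ (signAt-∉ xs ε) sum0))
  where
  σ = signAt xs ε
  ε≡ = signs∘signAt xs ε u
  sum0 : ∀ i → wsum σ (coord i) xs ≡ 0ℤ
  sum0 i = trans (sym (lookup-lincomb σ xs i))
    (trans (cong (λ δ → lookup (lincomb xs δ) i) ε≡)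
      (trans (cong (λ z → lookup z i) e) (Vecₚ.lookup-replicate i 0ℤ)))

Dissociated⇒Independent : ∀ (xs : List (Point n)) (u : Unique xs) → Dissociated (xs , u) → Independent xs
Dissociated⇒Independent xs u dis σ sum0 = signs-zer xs (dis (signs σ xs)
  (lookup⇒≡ λ i → trans (lookup-lincomb σ xs i) (trans (sum0 i) (sym (Vecₚ.lookup-replicate i 0ℤ)))))

-- Unit vectors and parity

unit : Fin n → Point n
unit zero    = 1ℤ ∷ replicate _ 0ℤ
unit (suc i) = 0ℤ ∷ unit i

lookup-unit : ∀ (i : Fin n) → lookup (unit i) i ≡ 1ℤ
lookup-unit zero    = refl
lookup-unit (suc i) = lookup-unit i

lookup-unit-≢ : ∀ (i j : Fin n) → i ≢ j → lookup (unit i) j ≡ 0ℤ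
lookup-unit-≢ zero    zero    i≢j = ⊥-elim (i≢j refl)
lookup-unit-≢ zero    (suc j) i≢j = Vecₚ.lookup-replicate j 0ℤ
lookup-unit-≢ (suc i) zero    i≢j = refl
lookup-unit-≢ (suc i) (suc j) i≢j = lookup-unit-≢ i j (i≢j ∘ cong suc)

unit-injective : ∀ {i j : Fin n} → unit i ≡ unit j → i ≡ j
unit-injective {i = i} {j} e with i Finₚ.≟ j
... | yes i≡j = i≡j
... | no  i≢j = contradiction
  (trans (sym (lookup-unit i)) (trans (cong (coord i) e) (lookup-unit-≢ j i (i≢j ∘ sym)))) λ ()

2k≢1 : ∀ k → 2 ℕ.* k ≢ 1
2k≢1 (suc k) e with trans (sym (ℕₚ.+-suc k (k ℕ.+ 0))) (ℕₚ.suc-injective e)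
... | ()

-- A nonzero sign is odd. Absolute values move the contradiction to the naturals, where `2k≢1`
-- applies. Every parity argument below goes through this lemma.
even-sign : ∀ s z → signℤ s ℤ.+ + 2 ℤ.* z ≡ 0ℤ → s ≡ zer
even-sign s z e = go s (trans (sym (ℤₚ.abs-* (+ 2) z)) (cong ℤ.∣_∣ 2z≡))
  where
  step : ∀ a b → b ≡ (a ℤ.+ b) ℤ.- a
  step = solve-∀
  2z≡ : + 2 ℤ.* z ≡ 0ℤ ℤ.- signℤ s
  2z≡ = trans (step (signℤ s) _) (cong (ℤ._- signℤ s) e)
  go : ∀ s → 2 ℕ.* ℤ.∣ z ∣ ≡ ℤ.∣ 0ℤ ℤ.- signℤ s ∣ → s ≡ zer
  go neg p = ⊥-elim (2k≢1 ℤ.∣ z ∣ p)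
  go zer p = refl
  go pos p = ⊥-elim (2k≢1 ℤ.∣ z ∣ p)

double≡0 : ∀ z → + 2 ℤ.* z ≡ 0ℤ → z ≡ 0ℤ
double≡0 z e with ℤₚ.i*j≡0⇒i≡0∨j≡0 (+ 2) e
... | inj₂ z≡0 = z≡0

-- Detecting families

Bit : ℤ → Set
Bit z = z ≡ 0ℤ ⊎ z ≡ 1ℤ

-- A family in r coordinates stands for the dissociated subset {(1, x) : x ∈ points} of {0,1}^(1+r).
record DetectingFamily (r c : ℕ) : Set where
  field
    points      : List (Point r)
    unique      : Unique points
    bits        : All (VecAll.All Bit) points
    card        : length points ≡ c
    independent : ∀ (σ : Point r → Sign) → wsum σ (λ _ → 1ℤ) points ≡ 0ℤ →
                  (∀ i → wsum σ (coord i) points ≡ 0ℤ) → ∀ {x} → x ∈ points → σ x ≡ zer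

-- The point without coordinates stands for the number 1, so the constant coordinate alone
-- determines its sign.
singletonFamily : DetectingFamily 0 1
singletonFamily = record
  { points      = [] ∷ []
  ; unique      = [] ∷ []
  ; bits        = VecAll.[] ∷ []
  ; card        = refl
  ; independent = λ { σ s _ (here refl) → even-sign (σ []) 0ℤ
      (trans (cong (ℤ._+ 0ℤ) (sym (ℤₚ.*-identityʳ (signℤ (σ []))))) s) }
  }

bits-replicate0 : ∀ r → VecAll.All Bit (replicate r 0ℤ)
bits-replicate0 zero    = VecAll.[]
bits-replicate0 (suc r) = inj₁ refl VecAll.∷ bits-replicate0 r

bits-unit : ∀ (i : Fin r) → VecAll.All Bit (unit i)
bits-unit zero    = inj₂ refl VecAll.∷ bits-replicate0 _
bits-unit (suc i) = inj₁ refl VecAll.∷ bits-unit i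

-- The added coordinate is nonzero only at the new point and hence kills its sign; the old family
-- handles the rest. This reaches the even dimensions, since doubling yields only odd ones.
extendFamily : ∀ {r c} → DetectingFamily r c → DetectingFamily (suc r) (suc c)
extendFamily {r} {c} F = record
  { points      = new ∷ map (0ℤ ∷_) points
  ; unique      = Allₚ.map⁺ (All.universal (λ _ ()) points) ∷ Uniqueₚ.map⁺ Vecₚ.∷-injectiveʳ unique
  ; bits        = (inj₂ refl VecAll.∷ bits-replicate0 r) ∷ Allₚ.map⁺ (All.map (inj₁ refl VecAll.∷_) bits)
  ; card        = cong suc (trans (Listₚ.length-map _ points) card)
  ; independent = ind
  }
  where
  open DetectingFamily F
  new : Point (suc r)
  new = 1ℤ ∷ replicate r 0ℤ
  ind : ∀ (σ : Point (suc r) → Sign) → wsum σ (λ _ → 1ℤ) (new ∷ map (0ℤ ∷_) points) ≡ 0ℤ →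
        (∀ i → wsum σ (coord i) (new ∷ map (0ℤ ∷_) points) ≡ 0ℤ) →
        ∀ {x} → x ∈ new ∷ map (0ℤ ∷_) points → σ x ≡ zer
  ind σ s sum0 = λ where
      (here refl) → σnew
      (there p)   → old p
    where
    σnew : σ new ≡ zer
    σnew = even-sign (σ new) 0ℤ (trans (sym (cong₂ ℤ._+_ (ℤₚ.*-identityʳ (signℤ (σ new)))
      (trans (wsum-map σ (coord zero) (0ℤ ∷_) points) (wsum-const0 _ points)))) (sum0 zero))
    dropNew : ∀ φ → wsum σ φ (new ∷ map (0ℤ ∷_) points) ≡ 0ℤ → wsum (σ ∘ (0ℤ ∷_)) (φ ∘ (0ℤ ∷_)) points ≡ 0ℤ
    dropNew φ e rewrite σnew = trans (sym (wsum-map σ φ (0ℤ ∷_) points)) (trans (sym (ℤₚ.+-identityˡ _)) e)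
    old : ∀ {x} → x ∈ map (0ℤ ∷_) points → σ x ≡ zer
    old x∈ with ∈-map⁻ (0ℤ ∷_) x∈
    ... | y , y∈ , refl = independent (σ ∘ (0ℤ ∷_)) (dropNew (λ _ → 1ℤ) s) (λ i → dropNew (coord (suc i)) (sum0 (suc i))) y∈

-- Counting the constant coordinate, n = r + 1 becomes 2n while c becomes 2c + n - 1. This recursion
-- is what makes c grow like (n/2) log₂ n = n log₄ n.
doubleFamily : ∀ {r c} → DetectingFamily r c → DetectingFamily (r ℕ.+ suc r) (c ℕ.+ (c ℕ.+ r))
doubleFamily {r} {c} F = record
  { points      = all
  ; unique      = Uniqueₚ.++⁺ (Uniqueₚ.map⁺ (λ {x} {y} → Vecₚ.++-injectiveˡ x y) unique)
                    (Uniqueₚ.++⁺ (Uniqueₚ.map⁺ (λ {x} {y} → Vecₚ.++-injectiveˡ x y) unique)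
                                 (Uniqueₚ.map⁺ (λ {i} {j} e → unit-injective (Vecₚ.++-injectiveˡ (unit i) (unit j) e)) (Uniqueₚ.allFin⁺ r))
                                 gh-disjoint)
                    f-disjoint
  ; bits        = Allₚ.++⁺ (Allₚ.map⁺ (All.map (λ b → VecAllₚ.++⁺ b (inj₂ refl VecAll.∷ b)) bits))
                    (Allₚ.++⁺ (Allₚ.map⁺ (All.map (λ b → VecAllₚ.++⁺ b (inj₁ refl VecAll.∷ VecAllₚ.map⁺ (VecAll.map bit-flip b))) bits))
                              (Allₚ.map⁺ (All.universal (λ i → VecAllₚ.++⁺ (bits-unit i) (inj₂ refl VecAll.∷ bits-replicate0 r)) (allFin r))))
  ; card        = trans (Listₚ.length-++ (map f points))
                    (cong₂ ℕ._+_ (trans (Listₚ.length-map f points) card)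
                      (trans (Listₚ.length-++ (map g points))
                        (cong₂ ℕ._+_ (trans (Listₚ.length-map g points) card)
                                     (trans (Listₚ.length-map h (allFin r)) (Listₚ.length-tabulate id)))))
  ; independent = ind
  }
  where
  open DetectingFamily F
  flip : ℤ → ℤ
  flip z = 1ℤ ℤ.- z
  bit-flip : ∀ {z} → Bit z → Bit (flip z)
  bit-flip (inj₁ refl) = inj₂ refl
  bit-flip (inj₂ refl) = inj₁ refl
  f g : Point r → Point (r ℕ.+ suc r)
  f x = x Vec.++ 1ℤ ∷ x
  g x = x Vec.++ 0ℤ ∷ Vec.map flip x
  h : Fin r → Point (r ℕ.+ suc r)
  h i = unit i Vec.++ 1ℤ ∷ replicate r 0ℤ
  all : List (Point (r ℕ.+ suc r))
  all = map f points ++ map g points ++ map h (allFin r)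

  gh-disjoint : ∀ {v} → v ∈ map g points × v ∈ map h (allFin r) → ⊥
  gh-disjoint (p , q) with ∈-map⁻ g p | ∈-map⁻ h q
  ... | x , _ , refl | i , _ , e with Vecₚ.++-injectiveʳ x (unit i) e
  ... | ()

  f-disjoint : ∀ {v} → v ∈ map f points × v ∈ map g points ++ map h (allFin r) → ⊥
  f-disjoint (p , q) with ∈-map⁻ f p | ∈-++⁻ (map g points) q
  f-disjoint (p , q) | x , _ , refl | inj₁ q′ with ∈-map⁻ g q′
  ... | y , _ , e with Vecₚ.++-injectiveʳ x y e
  ... | ()
  f-disjoint (p , q) | x , _ , refl | inj₂ q′ with ∈-map⁻ h q′
  -- Here the middle coordinates agree, but the outer halves would make `x` equal both to `unit i`
  -- and to zero.
  ... | i , _ , e with Vecₚ.++-injectiveˡ x (unit i) e | Vecₚ.∷-injectiveʳ (Vecₚ.++-injectiveʳ x (unit i) e)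
  ... | refl | e′ = contradiction (trans (sym (lookup-unit i)) (trans (cong (coord i) e′) (Vecₚ.lookup-replicate i 0ℤ))) λ ()

  ind : ∀ (σ : Point (r ℕ.+ suc r) → Sign) → wsum σ (λ _ → 1ℤ) all ≡ 0ℤ →
        (∀ i → wsum σ (coord i) all ≡ 0ℤ) → ∀ {x} → x ∈ all → σ x ≡ zer
  ind σ s sum0 x∈ = concl (∈-++⁻ (map f points) x∈)
    where
    split : ∀ φ → wsum σ φ all ≡
      wsum (σ ∘ f) (φ ∘ f) points ℤ.+ (wsum (σ ∘ g) (φ ∘ g) points ℤ.+ wsum (σ ∘ h) (φ ∘ h) (allFin r))
    split φ = trans (wsum-++ σ φ (map f points) _)
      (cong₂ ℤ._+_ (wsum-map σ φ f points)
        (trans (wsum-++ σ φ (map g points) _) (cong₂ ℤ._+_ (wsum-map σ φ g points) (wsum-map σ φ h (allFin r)))))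
    splitAs : ∀ φ {a b c} → wsum σ φ all ≡ 0ℤ → φ ∘ f ≗ a → φ ∘ g ≗ b → φ ∘ h ≗ c →
      wsum (σ ∘ f) a points ℤ.+ (wsum (σ ∘ g) b points ℤ.+ wsum (σ ∘ h) c (allFin r)) ≡ 0ℤ
    splitAs φ e p q t = trans (sym (trans (split φ)
      (cong₂ ℤ._+_ (wsum-cong (σ ∘ f) p points) (cong₂ ℤ._+_ (wsum-cong (σ ∘ g) q points) (wsum-cong (σ ∘ h) t (allFin r)))))) e
    one : ∀ {Y : Set} → Y → ℤ
    one _ = 1ℤ
    nil : ∀ {Y : Set} → Y → ℤ
    nil _ = 0ℤ
    sf = wsum (σ ∘ f) one points
    sg = wsum (σ ∘ g) one points
    sh = wsum (σ ∘ h) one (allFin r)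
    a b : Fin r → ℤ
    a i = wsum (σ ∘ f) (coord i) points
    b i = wsum (σ ∘ g) (coord i) points
    -- From here on a linear system in the sign totals and the coordinate sums `a`, `b` is solved.
    -- The middle coordinate is 1 on `f` and `h` and 0 on `g`.
    mid : sf ℤ.+ (0ℤ ℤ.+ sh) ≡ 0ℤ
    mid = trans (cong (λ z → sf ℤ.+ (z ℤ.+ sh)) (sym (wsum-const0 (σ ∘ g) points)))
      (splitAs (coord (r ↑ʳ zero)) {b = nil} (sum0 (r ↑ʳ zero))
        (λ x → Vecₚ.lookup-++ʳ x (1ℤ ∷ x) zero)
        (λ x → Vecₚ.lookup-++ʳ x (0ℤ ∷ Vec.map flip x) zero)
        (λ i → Vecₚ.lookup-++ʳ (unit i) (1ℤ ∷ replicate r 0ℤ) zero))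
    top : ∀ i → a i ℤ.+ (b i ℤ.+ signℤ (σ (h i))) ≡ 0ℤ
    top i = trans (cong (λ z → a i ℤ.+ (b i ℤ.+ z)) (sym (wsum-tabulate-δ (σ ∘ h) (λ j → lookup (unit j) i) id i (lookup-unit i) (λ j → lookup-unit-≢ j i))))
      (splitAs (coord (i ↑ˡ suc r)) (sum0 (i ↑ˡ suc r))
        (λ x → Vecₚ.lookup-++ˡ x (1ℤ ∷ x) i)
        (λ x → Vecₚ.lookup-++ˡ x (0ℤ ∷ Vec.map flip x) i)
        (λ j → Vecₚ.lookup-++ˡ (unit j) (1ℤ ∷ replicate r 0ℤ) i))
    bottom : ∀ i → a i ℤ.+ ((sg ℤ.- b i) ℤ.+ 0ℤ) ≡ 0ℤ
    bottom i = trans (cong₂ (λ y z → a i ℤ.+ (y ℤ.+ z)) (sym (wsum-minus (σ ∘ g) one (coord i) points)) (sym (wsum-const0 (σ ∘ h) (allFin r))))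
      (splitAs (coord (r ↑ʳ suc i)) {c = nil} (sum0 (r ↑ʳ suc i))
        (λ x → Vecₚ.lookup-++ʳ x (1ℤ ∷ x) (suc i))
        (λ x → trans (Vecₚ.lookup-++ʳ x (0ℤ ∷ Vec.map flip x) (suc i)) (Vecₚ.lookup-map i flip x))
        (λ j → trans (Vecₚ.lookup-++ʳ (unit j) (1ℤ ∷ replicate r 0ℤ) (suc i)) (Vecₚ.lookup-replicate i 0ℤ)))
    total : sf ℤ.+ (sg ℤ.+ sh) ≡ 0ℤ
    total = splitAs one s (λ _ → refl) (λ _ → refl) (λ _ → refl)
    -- The constant and the middle coordinate differ only on `g`, so their difference isolates `sg`.
    sg≡0 : sg ≡ 0ℤ
    sg≡0 = trans (eq sf sg sh) (cong₂ ℤ._-_ total mid)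
      where
      eq : ∀ x y z → y ≡ (x ℤ.+ (y ℤ.+ z)) ℤ.- (x ℤ.+ (0ℤ ℤ.+ z))
      eq = solve-∀
    -- The flipped copy contributes `sg - b i`, which is now just `- b i`.
    bottom′ : ∀ i → a i ℤ.- b i ≡ 0ℤ
    bottom′ i = trans (eq (a i) (b i)) (trans (cong (λ z → a i ℤ.+ ((z ℤ.- b i) ℤ.+ 0ℤ)) (sym sg≡0)) (bottom i))
      where
      eq : ∀ x y → x ℤ.- y ≡ x ℤ.+ ((0ℤ ℤ.- y) ℤ.+ 0ℤ)
      eq = solve-∀
    -- Subtracting `bottom′` from `top` leaves the sign of `h i` plus `2 * b i`, so parity decides.
    σh : ∀ i → σ (h i) ≡ zer
    σh i = even-sign (σ (h i)) (b i) (trans (eq (a i) (b i) (signℤ (σ (h i)))) (cong₂ ℤ._-_ (top i) (bottom′ i)))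
      where
      eq : ∀ x y z → z ℤ.+ + 2 ℤ.* y ≡ (x ℤ.+ (y ℤ.+ z)) ℤ.- (x ℤ.- y)
      eq = solve-∀
    top′ : ∀ i → a i ℤ.+ b i ≡ 0ℤ
    top′ i = trans (cong (λ z → a i ℤ.+ z) (sym (ℤₚ.+-identityʳ (b i))))
      (subst (λ t → a i ℤ.+ (b i ℤ.+ signℤ t) ≡ 0ℤ) (σh i) (top i))
    a≡0 : ∀ i → a i ≡ 0ℤ
    a≡0 i = double≡0 (a i) (trans (eq (a i) (b i)) (cong₂ ℤ._+_ (top′ i) (bottom′ i)))
      where
      eq : ∀ x y → + 2 ℤ.* x ≡ (x ℤ.+ y) ℤ.+ (x ℤ.- y)
      eq = solve-∀
    b≡0 : ∀ i → b i ≡ 0ℤ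
    b≡0 i = trans (eq (a i) (b i)) (cong₂ ℤ._-_ (top′ i) (a≡0 i))
      where
      eq : ∀ x y → y ≡ (x ℤ.+ y) ℤ.- x
      eq = solve-∀
    sf≡0 : sf ≡ 0ℤ
    sf≡0 = trans (eq sf) (trans (cong (λ z → sf ℤ.+ (0ℤ ℤ.+ z)) (sym (wsum-off (σ ∘ h) one (allFin r) λ {i} _ → σh i))) mid)
      where
      eq : ∀ x → x ≡ x ℤ.+ (0ℤ ℤ.+ 0ℤ)
      eq = solve-∀
    concl : ∀ {x} → x ∈ map f points ⊎ x ∈ map g points ++ map h (allFin r) → σ x ≡ zer
    concl (inj₁ p) with ∈-map⁻ f p
    ... | y , y∈ , refl = independent (σ ∘ f) sf≡0 a≡0 y∈
    concl (inj₂ p) with ∈-++⁻ (map g points) p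
    concl (inj₂ p) | inj₁ q with ∈-map⁻ g q
    ... | y , y∈ , refl = independent (σ ∘ g) sg≡0 b≡0 y∈
    concl (inj₂ p) | inj₂ q with ∈-map⁻ h q
    ... | i , _ , refl = σh i

-- Minimal spanning sets

-- Exhaustive search over three signs per element. The predicate absorbs the terms already chosen,
-- which keeps the recursion structural.
lincombs? : ∀ (xs : List (Point n)) {P : Point n → Set} → (∀ x → Dec (P x)) →
  Dec (∃ λ ε → P (lincomb xs ε))
lincombs? []       P? = map′ ([] ,_) (λ { ([] , p) → p }) (P? zeroPt)
lincombs? (x ∷ xs) {P} P? =
  map′ (λ { (inj₁ (ε , p)) → neg ∷ ε , p ; (inj₂ (inj₁ (ε , p))) → zer ∷ ε , p ; (inj₂ (inj₂ (ε , p))) → pos ∷ ε , p })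
       (λ { (neg ∷ ε , p) → inj₁ (ε , p) ; (zer ∷ ε , p) → inj₂ (inj₁ (ε , p)) ; (pos ∷ ε , p) → inj₂ (inj₂ (ε , p)) })
       (branch neg ⊎-dec (branch zer ⊎-dec branch pos))
  where
  branch : ∀ s → Dec (∃ λ ε → P (lincomb (x ∷ xs) (s ∷ ε)))
  branch s = lincombs? xs (λ y → P? (Vec.zipWith ℤ._+_ (scale s x) y))

-- Exhaustive search over the words of length `k` in the alphabet `as`; again the chosen prefix is
-- pushed into the predicate.
listsOver? : ∀ (as : List X) {Q : List X → Set} → (∀ xs → Dec (Q xs)) → ∀ k →
  Dec (∃ λ xs → All (_∈ as) xs × length xs ≡ k × Q xs)
listsOver? as Q? zero =
  map′ (λ q → [] , [] , refl , q) (λ { ([] , _ , _ , q) → q }) (Q? [])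
listsOver? as {Q} Q? (suc k) =
  map′ to from (Any.any? (λ x → listsOver? as (λ xs → Q? (x ∷ xs)) k) as)
  where
  to : Any (λ x → ∃ λ xs → All (_∈ as) xs × length xs ≡ k × Q (x ∷ xs)) as → ∃ λ xs → All (_∈ as) xs × length xs ≡ suc k × Q xs
  to p with find p
  ... | x , x∈ , xs , sub , len , q = x ∷ xs , x∈ ∷ sub , cong suc len , q
  from : (∃ λ xs → All (_∈ as) xs × length xs ≡ suc k × Q xs) → Any (λ x → ∃ λ xs → All (_∈ as) xs × length xs ≡ k × Q (x ∷ xs)) as
  from (x ∷ xs , x∈ ∷ sub , len , q) =
    Any.map (λ { refl → xs , sub , ℕₚ.suc-injective len , q }) x∈

spanningOfSize? : ∀ (A : FinSet n) k → Dec (∃ λ S → Spanning A S × ∣ S ∣ ≡ k)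
spanningOfSize? {n} A k = map′
  (λ { (xs , sub , len , u , span) → (xs , u) , (All.lookup sub , λ x x∈ → All.lookup span x∈) , len })
  (λ { ((xs , u) , (sub , span) , len) → xs , All.tabulate sub , len , u , All.tabulate (λ {x} → span x) })
  (listsOver? (elems A)
    (λ xs → unique? xs ×-dec All.all? (λ x → lincombs? xs (_≟ₚ x)) (elems A)) k)
  where open DecUnique (_≟ₚ_ {n}) using (unique?)

-- Upward search from 0; `d` counts the candidates left before the known witness `m`, so the search
-- stops.
least : ∀ {P : ℕ → Set} → (∀ k → Dec (P k)) → ∀ {m} → P m → ∃ λ k → P k × (∀ {j} → P j → k ≤ j) × k ≤ m
least {P} P? {m} Pm = go m 0 (ℕₚ.+-identityʳ m) (λ ()) 
  where
  go : ∀ d k → d ℕ.+ k ≡ m → (∀ {j} → j < k → ¬ P j) → ∃ λ k → P k × (∀ {j} → P j → k ≤ j) × k ≤ m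
  go d k e below with P? k
  ... | yes p = k , p , (λ {j} Pj → ℕₚ.≮⇒≥ (λ j<k → below j<k Pj)) , ℕₚ.≤-trans (ℕₚ.m≤n+m k d) (ℕₚ.≤-reflexive e)
  go zero    k e below | no ¬p = ⊥-elim (¬p (subst P (sym e) Pm))
  go (suc d) k e below | no ¬p = go d (suc k) (trans (ℕₚ.+-suc d k) e) below′
    where
    below′ : ∀ {j} → j < suc k → ¬ P j
    below′ j<1+k with ℕₚ.m≤n⇒m<n∨m≡n (ℕₚ.≤-pred j<1+k)
    ... | inj₁ j<k  = below j<k
    ... | inj₂ refl = ¬p

-- `IsDs` asks for an exact minimum, whereas the construction supplies an explicit spanning set and
-- thus an upper bound. The minimum itself is obtained by search.
ds-exists : ∀ (A S : FinSet n) → Spanning A S → ∃ λ k → IsDs A k × k ≤ ∣ S ∣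
ds-exists A S span with least (spanningOfSize? A) (S , span , refl)
... | k , p , min , k≤ = k , (p , λ S′ span′ → min (S′ , span′ , refl)) , k≤

-- The extremal set

unitList : ∀ n → List (Point n)
unitList n = map unit (allFin n)

∈-unitList⁺ : ∀ (i : Fin n) → unit i ∈ unitList n
∈-unitList⁺ i = ∈-map⁺ unit (∈-allFin i)

∈-unitList⁻ : ∀ n {x} → x ∈ unitList n → ∃ λ i → x ≡ unit i
∈-unitList⁻ n p with ∈-map⁻ unit p
... | i , _ , e = i , e

length-unitList : ∀ n → length (unitList n) ≡ n
length-unitList n = trans (Listₚ.length-map unit (allFin n)) (Listₚ.length-tabulate id)

unitList-unique : ∀ n → Unique (unitList n)
unitList-unique n = Uniqueₚ.map⁺ unit-injective (Uniqueₚ.allFin⁺ n)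

bits-unitList : ∀ n → All (VecAll.All Bit) (unitList n)
bits-unitList n = Allₚ.map⁺ (All.universal bits-unit (allFin n))

wsum-unitList : ∀ (σ : Point n → Sign) j → wsum σ (coord j) (unitList n) ≡ signℤ (σ (unit j))
wsum-unitList {n} σ j = trans (wsum-map σ (coord j) unit (allFin n))
  (wsum-tabulate-δ (σ ∘ unit) (coord j ∘ unit) id j (lookup-unit j) (λ i → lookup-unit-≢ i j))

module Construction {r c} (F : DetectingFamily (suc r) c) where
  open DetectingFamily F
  open DecMembership (_≟ₚ_ {suc (suc r)}) using (_∈?_)

  ones : Point (suc (suc r))
  ones = replicate _ 1ℤ

  -- Twice the point (1, x) for which `x` stands in the family.
  lift : Point (suc r) → Point (suc (suc r))
  lift x = + 2 ∷ Vec.map (+ 2 ℤ.*_) x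

  units core lifted total : List (Point (suc (suc r)))
  units  = unitList (suc (suc r))
  core   = ones ∷ units
  lifted = map lift points
  total  = core ++ lifted

  -- Dimension at least two matters: in dimension one the unit vector is the all-ones vector.
  unit≢ones : ∀ i → unit i ≢ ones
  unit≢ones zero    ()
  unit≢ones (suc i) ()

  ones≢lift : ∀ x → ones ≢ lift x
  ones≢lift x ()

  unit≢lift : ∀ i x → unit i ≢ lift x
  unit≢lift zero    x ()
  unit≢lift (suc i) x ()

  lift-injective : ∀ {x y} → lift x ≡ lift y → x ≡ y
  lift-injective {x} {y} e = lookup⇒≡ λ i → ℤₚ.*-cancelˡ-≡ (+ 2) _ _
    (trans (sym (Vecₚ.lookup-map i (+ 2 ℤ.*_) x))
      (trans (cong (coord i) (Vecₚ.∷-injectiveʳ e)) (Vecₚ.lookup-map i (+ 2 ℤ.*_) y)))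

  ones∉units : ones ∉ units
  ones∉units p with ∈-unitList⁻ (suc (suc r)) p
  ... | i , e = unit≢ones i (sym e)

  core-unique : Unique core
  core-unique = Allₚ.¬Any⇒All¬ units ones∉units ∷ unitList-unique _

  total-unique : Unique total
  total-unique = Uniqueₚ.++⁺ core-unique (Uniqueₚ.map⁺ lift-injective unique) disjoint
    where
    disjoint : ∀ {v} → v ∈ core × v ∈ lifted → ⊥
    disjoint (p , q) with ∈-map⁻ lift q
    disjoint (here e , q)  | x , _ , refl = ones≢lift x (sym e)
    disjoint (there p , q) | x , _ , refl with ∈-unitList⁻ (suc (suc r)) p
    ... | i , e = unit≢lift i x (sym e)

  A : FinSet (suc (suc r))
  A = total , total-unique

  length-core : length core ≡ suc (suc (suc r))
  length-core = cong suc (length-unitList _)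

  length-total : length total ≡ suc (suc (suc r) ℕ.+ c)
  length-total = trans (Listₚ.length-++ core) (cong₂ ℕ._+_ length-core (trans (Listₚ.length-map lift points) card))

  digits : In012 A
  digits = digits-ones ∷ Allₚ.++⁺ (All.map (VecAll.map bit⇒digit) (bits-unitList (suc (suc r))))
                                  (Allₚ.map⁺ (All.map (λ b → inj₂ (inj₂ refl) VecAll.∷ VecAllₚ.map⁺ (VecAll.map double-digit b)) bits))
    where
    bit⇒digit : ∀ {z} → Bit z → Digit z
    bit⇒digit (inj₁ e) = inj₁ e
    bit⇒digit (inj₂ e) = inj₂ (inj₁ e)
    double-digit : ∀ {z} → Bit z → Digit (+ 2 ℤ.* z)
    double-digit (inj₁ refl) = inj₁ refl
    double-digit (inj₂ refl) = inj₂ (inj₂ refl)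
    digits-replicate1 : ∀ n → VecAll.All Digit (replicate n 1ℤ)
    digits-replicate1 zero    = VecAll.[]
    digits-replicate1 (suc n) = inj₂ (inj₁ refl) VecAll.∷ digits-replicate1 n
    digits-ones : VecAll.All Digit ones
    digits-ones = digits-replicate1 _

  -- Relations on the set, read modulo 2

  wsum-core : ∀ σ j → wsum σ (coord j) core ≡ signℤ (σ ones) ℤ.+ signℤ (σ (unit j))
  wsum-core σ j = cong₂ ℤ._+_
    (trans (cong (signℤ (σ ones) ℤ.*_) (Vecₚ.lookup-replicate j 1ℤ)) (ℤₚ.*-identityʳ (signℤ (σ ones))))
    (wsum-unitList σ j)

  halfCoord : Fin (suc (suc r)) → Point (suc r) → ℤ
  halfCoord zero    x = 1ℤ
  halfCoord (suc i) x = lookup x i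

  coord-lift : ∀ j x → coord j (lift x) ≡ + 2 ℤ.* halfCoord j x
  coord-lift zero    x = refl
  coord-lift (suc i) x = Vecₚ.lookup-map i (+ 2 ℤ.*_) x

  wsum-total : ∀ σ j → wsum σ (coord j) total ≡
    (signℤ (σ ones) ℤ.+ signℤ (σ (unit j))) ℤ.+ + 2 ℤ.* wsum (σ ∘ lift) (halfCoord j) points
  wsum-total σ j = trans (wsum-++ σ (coord j) core lifted) (cong₂ ℤ._+_ (wsum-core σ j)
    (trans (wsum-map σ (coord j) lift points)
      (trans (wsum-cong (σ ∘ lift) (coord-lift j) points) (wsum-double (σ ∘ lift) (halfCoord j) points))))

  -- Modulo 2, coordinate j says that ones and unit j carry signs of equal parity.
  dependence-uses-core : ∀ σ → (∀ j → wsum σ (coord j) total ≡ 0ℤ) →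
    ∀ {a} → a ∈ core → σ a ≡ zer → ∀ {x} → x ∈ total → σ x ≡ zer
  dependence-uses-core σ sum0 {a} a∈ σa x∈ = concl (∈-++⁻ core x∈)
    where
    t : Fin (suc (suc r)) → ℤ
    t j = wsum (σ ∘ lift) (halfCoord j) points
    row : ∀ j → (signℤ (σ ones) ℤ.+ signℤ (σ (unit j))) ℤ.+ + 2 ℤ.* t j ≡ 0ℤ
    row j = trans (sym (wsum-total σ j)) (sum0 j)
    σones : a ∈ core → σ ones ≡ zer
    σones (here refl) = σa
    σones (there p) with ∈-unitList⁻ (suc (suc r)) p
    ... | i , refl = even-sign (σ ones) (t i)
      (trans (cong (ℤ._+ + 2 ℤ.* t i) (sym (trans (cong (λ s → signℤ (σ ones) ℤ.+ signℤ s) σa) (ℤₚ.+-identityʳ (signℤ (σ ones)))))) (row i))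
    row′ : ∀ j → signℤ (σ (unit j)) ℤ.+ + 2 ℤ.* t j ≡ 0ℤ
    row′ j = trans (cong (ℤ._+ + 2 ℤ.* t j) (sym (trans (cong (λ s → signℤ s ℤ.+ signℤ (σ (unit j))) (σones a∈)) (ℤₚ.+-identityˡ (signℤ (σ (unit j))))))) (row j)
    σunit : ∀ j → σ (unit j) ≡ zer
    σunit j = even-sign (σ (unit j)) (t j) (row′ j)
    t≡0 : ∀ j → t j ≡ 0ℤ
    t≡0 j = double≡0 (t j) (trans (sym (trans (cong (λ s → signℤ s ℤ.+ + 2 ℤ.* t j) (σunit j)) (ℤₚ.+-identityˡ _))) (row′ j))
    concl : ∀ {x} → x ∈ core ⊎ x ∈ lifted → σ x ≡ zer
    concl (inj₁ (here refl)) = σones a∈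
    concl (inj₁ (there p)) with ∈-unitList⁻ (suc (suc r)) p
    ... | i , refl = σunit i
    concl (inj₂ p) with ∈-map⁻ lift p
    -- `t zero` is the sum for the constant coordinate of the family; the other `t` belong to its
    -- proper coordinates.
    ... | y , y∈ , refl = independent (σ ∘ lift) (t≡0 zero) (t≡0 ∘ suc) y∈

  -- The set A without `a`. Removal is recorded as a permutation so that signed sums over both sets
  -- can be compared by `wsum-↭`.
  record Complement (a : Point (suc (suc r))) : Set where
    field
      set         : FinSet (suc (suc r))
      perm        : total ↭ a ∷ elems set
      size        : ∣ set ∣ ≡ suc (suc r) ℕ.+ c
      dissociated : Dissociated set

  -- A relation on the smaller set becomes one on A when `a` receives the sign `zer`; by
  -- `dependence-uses-core` such a relation is trivial.
  complement : ∀ {a} → a ∈ core → Complement a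
  complement {a} a∈ with ∈⇒↭-∷ (∈-++⁺ˡ {ys = lifted} a∈)
  ... | B , p with Unique-resp-↭ p total-unique
  ... | a# ∷ u = record
    { set         = B , u
    ; perm        = p
    ; size        = ℕₚ.suc-injective (trans (sym (Permₚ.↭-length p)) length-total)
    ; dissociated = signsVanish⇒Dissociated B u ind
    }
    where
    ind : ∀ σ → (∀ {y} → y ∉ B → σ y ≡ zer) → (∀ i → wsum σ (coord i) B ≡ 0ℤ) → ∀ {x} → x ∈ B → σ x ≡ zer
    ind σ off sum0 x∈ =
      dependence-uses-core σ sum0′ a∈ σa (Permₚ.∈-resp-↭ (↭-sym p) (there x∈))
      where
      σa : σ a ≡ zer
      -- `a` is absent from `B` because A has no repetition, so the default sign applies.
      σa = off (λ a∈B → All.lookup a# a∈B refl)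
      sum0′ : ∀ j → wsum σ (coord j) total ≡ 0ℤ
      sum0′ j = trans (wsum-↭ σ (coord j) p)
        (trans (cong (λ s → signℤ s ℤ.* coord j a ℤ.+ wsum σ (coord j) B) σa) (trans (ℤₚ.+-identityˡ _) (sum0 j)))

  -- Prescribed signs on the core, extended by `zer`. They serve both for the relation among the
  -- core elements and for writing points of A as combinations of the core.
  signFor : Sign → (Fin (suc (suc r)) → Sign) → Point (suc (suc r)) → Sign
  signFor s τ x with x ≟ₚ ones | Finₚ.any? (λ i → x ≟ₚ unit i)
  ... | yes _ | _           = s
  ... | no  _ | yes (i , _) = τ i
  ... | no  _ | no _        = zer

  signFor-ones : ∀ s τ → signFor s τ ones ≡ s
  signFor-ones s τ with ones ≟ₚ ones | Finₚ.any? (λ i → ones ≟ₚ unit i)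
  ... | yes _ | _ = refl
  ... | no ¬p | _ = ⊥-elim (¬p refl)

  signFor-unit : ∀ s τ j → signFor s τ (unit j) ≡ τ j
  signFor-unit s τ j with unit j ≟ₚ ones | Finₚ.any? (λ i → unit j ≟ₚ unit i)
  ... | yes p | _           = ⊥-elim (unit≢ones j p)
  ... | no  _ | yes (i , e) = cong τ (sym (unit-injective e))
  ... | no  _ | no ¬p       = ⊥-elim (¬p (j , refl))

  signFor-∉ : ∀ s τ {x} → x ∉ core → signFor s τ x ≡ zer
  signFor-∉ s τ {x} x∉ with x ≟ₚ ones | Finₚ.any? (λ i → x ≟ₚ unit i)
  ... | yes p | _              = ⊥-elim (x∉ (here p))
  ... | no  _ | yes (i , refl) = ⊥-elim (x∉ (there (∈-unitList⁺ i)))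
  ... | no  _ | no _           = refl

  wsum-signFor : ∀ s τ j → wsum (signFor s τ) (coord j) core ≡ signℤ s ℤ.+ signℤ (τ j)
  wsum-signFor s τ j = trans (wsum-core (signFor s τ) j)
    (cong₂ (λ a b → signℤ a ℤ.+ signℤ b) (signFor-ones s τ) (signFor-unit s τ j))

  -- The relation v - Σ eᵢ = 0, extended by `zer` to the rest of `D`, is nontrivial.
  core⊈dissociated : ∀ (D : FinSet (suc (suc r))) → Dissociated D → ¬ core ⊆ elems D
  core⊈dissociated (D , u) dis sub with ⊆⇒↭-++ core-unique sub
  ... | zs , p = contradiction (trans (sym (signFor-ones pos (λ _ → neg)))
      (Dissociated⇒Independent D u dis σ sum0 (sub (here refl)))) λ ()
    where
    σ = signFor pos (λ _ → neg)
    zs-off : ∀ {x} → x ∈ zs → σ x ≡ zer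
    zs-off x∈ = signFor-∉ pos (λ _ → neg) (λ x∈core → Unique-++⇒disjoint core (Unique-resp-↭ p u) x∈core x∈)
    sum0 : ∀ j → wsum σ (coord j) D ≡ 0ℤ
    sum0 j = trans (wsum-↭ σ (coord j) p) (trans (wsum-++ σ (coord j) core zs)
      (cong₂ ℤ._+_ (wsum-signFor pos (λ _ → neg) j) (wsum-off σ (coord j) zs zs-off)))

  ⊆complement : ∀ {a} (C : Complement a) {D : FinSet (suc (suc r))} → D ⊆ₛ A → a ∉ elems D → D ⊆ₛ Complement.set C
  ⊆complement C D⊆A a∉D x∈ with Permₚ.∈-resp-↭ (Complement.perm C) (D⊆A x∈)
  ... | here refl = ⊥-elim (a∉D x∈)
  ... | there q   = q

  complement⊆ : ∀ {a} (C : Complement a) → Complement.set C ⊆ₛ A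
  complement⊆ C x∈ = Permₚ.∈-resp-↭ (↭-sym (Complement.perm C)) (there x∈)

  missing : ∀ (D : FinSet (suc (suc r))) → Dissociated D → ∃ λ a → a ∈ core × a ∉ elems D
  missing D dis with All.all? (_∈? elems D) core
  ... | yes all = ⊥-elim (core⊈dissociated D dis (All.lookup all))
  ... | no ¬all = find (Allₚ.¬All⇒Any¬ (_∈? elems D) core ¬all)

  -- Hence a maximal dissociated subset must be A without one core element. These sets all have the
  -- same size, which gives both `isDd` and `isDdMinus`.
  dissociated⊆complement : ∀ (D : FinSet (suc (suc r))) → D ⊆ₛ A → Dissociated D →
    ∃ λ a → Σ (Complement a) λ C → D ⊆ₛ Complement.set C
  dissociated⊆complement D D⊆A dis with missing D dis
  ... | a , a∈ , a∉D = a , C , ⊆complement C {D} D⊆A a∉D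
    where C = complement a∈

  -- The dissociated dimensions and the spanning bound

  private
    C₀ = complement (here refl)
    module C₀ = Complement C₀

  isDd : IsDd A (suc (suc r) ℕ.+ c)
  isDd = (C₀.set , complement⊆ C₀ , C₀.dissociated , C₀.size) , bound
    where
    bound : ∀ D → D ⊆ₛ A → Dissociated D → ∣ D ∣ ≤ suc (suc r) ℕ.+ c
    bound D D⊆A dis with dissociated⊆complement D D⊆A dis
    ... | a , C , D⊆C = subst (∣ D ∣ ≤_) (Complement.size C) (⊆⇒length≤ (proj₂ D) D⊆C)

  isDdMinus : IsDdMinus A (suc (suc r) ℕ.+ c)
  isDdMinus = (C₀.set , (complement⊆ C₀ , C₀.dissociated , maximal) , C₀.size) , bound
    where
    maximal : ∀ D → D ⊆ₛ A → Dissociated D → C₀.set ⊆ₛ D → D ⊆ₛ C₀.set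
    -- `C₀` omits only `ones` and so contains all unit vectors; a larger `D` containing `ones` too
    -- would contain the whole core.
    maximal D D⊆A dis C₀⊆D = ⊆complement C₀ {D} D⊆A λ ones∈D → core⊈dissociated D dis λ where
      (here refl) → ones∈D
      (there p)   → C₀⊆D (⊆complement C₀ {units , unitList-unique _}
        (λ q → there (∈-++⁺ˡ q)) ones∉units p)
    bound : ∀ M → MaximalDissociated A M → suc (suc r) ℕ.+ c ≤ ∣ M ∣
    bound M (M⊆A , dis , max) with dissociated⊆complement M M⊆A dis
    -- Maximality forces `M` to contain the dissociated set `C` in which it lies.
    ... | a , C , M⊆C = subst (_≤ ∣ M ∣) (Complement.size C) (⊆⇒length≤ (proj₂ (Complement.set C))
      (max (Complement.set C) (complement⊆ C) (Complement.dissociated C) M⊆C))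

  inSpanCore : ∀ s τ x → (∀ j → signℤ s ℤ.+ signℤ (τ j) ≡ lookup x j) → InSpan (core , core-unique) x
  inSpanCore s τ x e = signs (signFor s τ) core , lookup⇒≡ λ j →
    trans (lookup-lincomb (signFor s τ) core j) (trans (wsum-signFor s τ j) (e j))

  -- 2d = ones + Σ (2 dᵢ − 1) unit i
  coreSpanning : Spanning A (core , core-unique)
  coreSpanning = ∈-++⁺ˡ , λ x x∈ → span x (∈-++⁻ core x∈)
    where
    indicator : ∀ {n} → Fin n → Fin n → Sign
    indicator i j with i Finₚ.≟ j
    ... | yes _ = pos
    ... | no  _ = zer
    indicator-unit : ∀ {n} (i j : Fin n) → 0ℤ ℤ.+ signℤ (indicator i j) ≡ lookup (unit i) j
    indicator-unit i j with i Finₚ.≟ j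
    ... | yes refl = sym (lookup-unit i)
    ... | no i≢j   = sym (lookup-unit-≢ i j i≢j)
    sgn : ∀ {z} → Bit z → Sign
    sgn (inj₁ _) = neg
    sgn (inj₂ _) = pos
    sgn-double : ∀ {z} (b : Bit z) → 1ℤ ℤ.+ signℤ (sgn b) ≡ + 2 ℤ.* z
    sgn-double (inj₁ refl) = refl
    sgn-double (inj₂ refl) = refl
    span : ∀ x → x ∈ core ⊎ x ∈ lifted → InSpan (core , core-unique) x
    span x (inj₁ (here refl)) = inSpanCore pos (λ _ → zer) x λ j → sym (Vecₚ.lookup-replicate j 1ℤ)
    span x (inj₁ (there p)) with ∈-unitList⁻ (suc (suc r)) p
    ... | i , refl = inSpanCore zer (indicator i) x (indicator-unit i)
    span x (inj₂ p) with ∈-map⁻ lift p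
    ... | y , y∈ , refl = inSpanCore pos τ x τ-ok
      where
      bs = All.lookup bits y∈
      -- The first coordinate of `lift y` is 2 = 1 + 1, hence `pos` at `zero`.
      τ : Fin (suc (suc r)) → Sign
      τ zero    = pos
      τ (suc i) = sgn (VecAllₚ.lookup⁺ bs i)
      τ-ok : ∀ j → 1ℤ ℤ.+ signℤ (τ j) ≡ lookup (lift y) j
      τ-ok zero    = refl
      τ-ok (suc i) = trans (sgn-double (VecAllₚ.lookup⁺ bs i)) (sym (Vecₚ.lookup-map i (+ 2 ℤ.*_) y))

  ds : ∃ λ k → IsDs A k × k ≤ suc (suc (suc r))
  ds with ds-exists A (core , core-unique) coreSpanning
  ... | k , isDs , k≤ = k , isDs , subst (k ≤_) length-core k≤

-- Sizes of the families

-- Here n counts the constant coordinate too, and `L` is the integer part of log₂ n. The surplus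
-- `L + 3` in `lower` carries the induction: it pays for the constant lost in doubling and for the
-- additional `L` that an extension costs.
record FamilyBounds (n c L : ℕ) : Set where
  field
    2^L≤n : 2 ℕ.^ L ≤ n
    n<2^1+L : n < 2 ℕ.^ suc L
    lower : n ℕ.* L ℕ.+ L ℕ.+ 3 ≤ 2 ℕ.* c ℕ.+ n
    upper : 2 ℕ.* c ≤ n ℕ.* (L ℕ.+ 2)

singletonBounds : FamilyBounds 1 1 0
singletonBounds = record { 2^L≤n = ℕₚ.≤-refl ; n<2^1+L = ℕₚ.≤-refl ; lower = ℕₚ.≤-refl ; upper = ℕₚ.≤-refl }

doubleBounds : ∀ {r c L} → FamilyBounds (suc r) c L →
  FamilyBounds (suc (r ℕ.+ suc r)) (c ℕ.+ (c ℕ.+ r)) (suc L)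
doubleBounds {r} {c} {L} B = record
  { 2^L≤n   = subst (2 ℕ.^ suc L ≤_) (eq₁ r) (ℕₚ.*-monoʳ-≤ 2 2^L≤n)
  ; n<2^1+L = ℕₚ.≤-trans (subst (suc (suc (r ℕ.+ suc r)) ≤_) (eq₂ r) (ℕₚ.n≤1+n _)) (ℕₚ.*-monoʳ-≤ 2 n<2^1+L)
  ; lower   = begin
      suc (r ℕ.+ suc r) ℕ.* suc L ℕ.+ suc L ℕ.+ 3       ≤⟨ ℕₚ.m≤m+n _ L ⟩
      suc (r ℕ.+ suc r) ℕ.* suc L ℕ.+ suc L ℕ.+ 3 ℕ.+ L ≡⟨ eq₃ r L ⟩
      2 ℕ.* (suc r ℕ.* L ℕ.+ L ℕ.+ 3) ℕ.+ 2 ℕ.* r       ≤⟨ ℕₚ.+-monoˡ-≤ (2 ℕ.* r) (ℕₚ.*-monoʳ-≤ 2 lower) ⟩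
      2 ℕ.* (2 ℕ.* c ℕ.+ suc r) ℕ.+ 2 ℕ.* r             ≡⟨ eq₄ r c ⟩
      2 ℕ.* (c ℕ.+ (c ℕ.+ r)) ℕ.+ suc (r ℕ.+ suc r)     ∎
  ; upper   = begin
      2 ℕ.* (c ℕ.+ (c ℕ.+ r))                           ≡⟨ eq₅ r c ⟩
      2 ℕ.* (2 ℕ.* c) ℕ.+ 2 ℕ.* r                       ≤⟨ ℕₚ.+-monoˡ-≤ (2 ℕ.* r) (ℕₚ.*-monoʳ-≤ 2 upper) ⟩
      2 ℕ.* (suc r ℕ.* (L ℕ.+ 2)) ℕ.+ 2 ℕ.* r           ≤⟨ ℕₚ.m≤m+n _ 2 ⟩
      2 ℕ.* (suc r ℕ.* (L ℕ.+ 2)) ℕ.+ 2 ℕ.* r ℕ.+ 2     ≡⟨ eq₆ r L ⟩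
      suc (r ℕ.+ suc r) ℕ.* (suc L ℕ.+ 2)               ∎
  }
  where
  open FamilyBounds B
  open ℕₚ.≤-Reasoning
  eq₁ : ∀ r → 2 ℕ.* suc r ≡ suc (r ℕ.+ suc r)
  eq₁ = ℕSolver.solve-∀
  eq₂ : ∀ r → suc (suc (suc (r ℕ.+ suc r))) ≡ 2 ℕ.* suc (suc r)
  eq₂ = ℕSolver.solve-∀
  eq₃ : ∀ r L → suc (r ℕ.+ suc r) ℕ.* suc L ℕ.+ suc L ℕ.+ 3 ℕ.+ L ≡ 2 ℕ.* (suc r ℕ.* L ℕ.+ L ℕ.+ 3) ℕ.+ 2 ℕ.* r
  eq₃ = ℕSolver.solve-∀
  eq₄ : ∀ r c → 2 ℕ.* (2 ℕ.* c ℕ.+ suc r) ℕ.+ 2 ℕ.* r ≡ 2 ℕ.* (c ℕ.+ (c ℕ.+ r)) ℕ.+ suc (r ℕ.+ suc r)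
  eq₄ = ℕSolver.solve-∀
  eq₅ : ∀ r c → 2 ℕ.* (c ℕ.+ (c ℕ.+ r)) ≡ 2 ℕ.* (2 ℕ.* c) ℕ.+ 2 ℕ.* r
  eq₅ = ℕSolver.solve-∀
  eq₆ : ∀ r L → 2 ℕ.* (suc r ℕ.* (L ℕ.+ 2)) ℕ.+ 2 ℕ.* r ℕ.+ 2 ≡ suc (r ℕ.+ suc r) ℕ.* (suc L ℕ.+ 2)
  eq₆ = ℕSolver.solve-∀

doubleExtendBounds : ∀ {r c L} → FamilyBounds (suc r) c L →
  FamilyBounds (suc (suc (r ℕ.+ suc r))) (suc (c ℕ.+ (c ℕ.+ r))) (suc L)
doubleExtendBounds {r} {c} {L} B = record
  { 2^L≤n   = ℕₚ.m≤n⇒m≤1+n (FamilyBounds.2^L≤n (doubleBounds B))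
  ; n<2^1+L = subst (_≤ 2 ℕ.^ suc (suc L)) (eq₂ r) (ℕₚ.*-monoʳ-≤ 2 n<2^1+L)
  ; lower   = begin
      suc (suc (r ℕ.+ suc r)) ℕ.* suc L ℕ.+ suc L ℕ.+ 3           ≤⟨ ℕₚ.m≤m+n _ 2 ⟩
      suc (suc (r ℕ.+ suc r)) ℕ.* suc L ℕ.+ suc L ℕ.+ 3 ℕ.+ 2     ≡⟨ eq₃ r L ⟩
      2 ℕ.* (suc r ℕ.* L ℕ.+ L ℕ.+ 3) ℕ.+ (2 ℕ.* r ℕ.+ 3)         ≤⟨ ℕₚ.+-monoˡ-≤ (2 ℕ.* r ℕ.+ 3) (ℕₚ.*-monoʳ-≤ 2 lower) ⟩
      2 ℕ.* (2 ℕ.* c ℕ.+ suc r) ℕ.+ (2 ℕ.* r ℕ.+ 3)               ≡⟨ eq₄ r c ⟩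
      2 ℕ.* suc (c ℕ.+ (c ℕ.+ r)) ℕ.+ suc (suc (r ℕ.+ suc r))     ∎
  ; upper   = begin
      2 ℕ.* suc (c ℕ.+ (c ℕ.+ r))                                 ≡⟨ eq₅ r c ⟩
      2 ℕ.* (2 ℕ.* c) ℕ.+ 2 ℕ.* suc r                             ≤⟨ ℕₚ.+-monoˡ-≤ (2 ℕ.* suc r) (ℕₚ.*-monoʳ-≤ 2 upper) ⟩
      2 ℕ.* (suc r ℕ.* (L ℕ.+ 2)) ℕ.+ 2 ℕ.* suc r                 ≤⟨ ℕₚ.m≤m+n _ (suc L ℕ.+ 2) ⟩
      2 ℕ.* (suc r ℕ.* (L ℕ.+ 2)) ℕ.+ 2 ℕ.* suc r ℕ.+ (suc L ℕ.+ 2) ≡⟨ eq₆ r L ⟩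
      suc (suc (r ℕ.+ suc r)) ℕ.* (suc L ℕ.+ 2)                   ∎
  }
  where
  open FamilyBounds B
  open ℕₚ.≤-Reasoning
  eq₂ : ∀ r → 2 ℕ.* suc (suc r) ≡ suc (suc (suc (r ℕ.+ suc r)))
  eq₂ = ℕSolver.solve-∀
  eq₃ : ∀ r L → suc (suc (r ℕ.+ suc r)) ℕ.* suc L ℕ.+ suc L ℕ.+ 3 ℕ.+ 2 ≡ 2 ℕ.* (suc r ℕ.* L ℕ.+ L ℕ.+ 3) ℕ.+ (2 ℕ.* r ℕ.+ 3)
  eq₃ = ℕSolver.solve-∀
  eq₄ : ∀ r c → 2 ℕ.* (2 ℕ.* c ℕ.+ suc r) ℕ.+ (2 ℕ.* r ℕ.+ 3) ≡ 2 ℕ.* suc (c ℕ.+ (c ℕ.+ r)) ℕ.+ suc (suc (r ℕ.+ suc r))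
  eq₄ = ℕSolver.solve-∀
  eq₅ : ∀ r c → 2 ℕ.* suc (c ℕ.+ (c ℕ.+ r)) ≡ 2 ℕ.* (2 ℕ.* c) ℕ.+ 2 ℕ.* suc r
  eq₅ = ℕSolver.solve-∀
  eq₆ : ∀ r L → 2 ℕ.* (suc r ℕ.* (L ℕ.+ 2)) ℕ.+ 2 ℕ.* suc r ℕ.+ (suc L ℕ.+ 2) ≡ suc (suc (r ℕ.+ suc r)) ℕ.* (suc L ℕ.+ 2)
  eq₆ = ℕSolver.solve-∀

-- The indices have exactly the form of the dimensions produced by `doubleFamily` and by
-- `extendFamily` after it.
data Halving : ℕ → Set where
  base : Halving 0
  odd  : ∀ k → Halving (k ℕ.+ suc k)
  even : ∀ k → Halving (suc (k ℕ.+ suc k))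

halving : ∀ r → Halving r
halving zero    = base
halving (suc r) with halving r
... | base   = odd 0
... | odd k  = even k
... | even k = subst Halving (cong suc (ℕₚ.+-suc k (suc k))) (odd (suc k))

largeFamily : ∀ r → ∃ λ c → ∃ λ L → DetectingFamily r c × FamilyBounds (suc r) c L
largeFamily = <-rec _ go
  where
  k<k+1+k : ∀ k → k < k ℕ.+ suc k
  k<k+1+k k = ℕₚ.m≤n+m (suc k) k
  go : ∀ r → (∀ {k} → k < r → ∃ λ c → ∃ λ L → DetectingFamily k c × FamilyBounds (suc k) c L) →
       ∃ λ c → ∃ λ L → DetectingFamily r c × FamilyBounds (suc r) c L
  go r rec with halving r
  ... | base = 1 , 0 , singletonFamily , singletonBounds
  ... | odd k with rec (k<k+1+k k)
  ...   | c , L , F , B = _ , _ , doubleFamily F , doubleBounds B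
  go r rec | even k with rec (ℕₚ.m≤n⇒m≤1+n (k<k+1+k k))
  ...   | c , L , F , B = _ , _ , extendFamily (doubleFamily F) , doubleExtendBounds B

-- Asymptotics

-- `L` is again the integer part of log₂ n, so both bounds place `dd` at n log₄ n + O(n). As d_d and
-- d_d^- coincide for these sets, `dd` stands for both.
record Growth (n dd ds : ℕ) : Set where
  field
    L       : ℕ
    2^L≤n   : 2 ℕ.^ L ≤ n
    n<2^1+L : n < 2 ℕ.^ suc L
    dd-lower : n ℕ.* L ≤ 2 ℕ.* dd
    dd-upper : 2 ℕ.* dd ≤ n ℕ.* (L ℕ.+ 4)
    ds-upper : ds ≤ suc n

record Example (n : ℕ) : Set where
  field
    set       : FinSet n
    digits    : In012 set
    dd ds     : ℕ
    isDd      : IsDd set dd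
    isDdMinus : IsDdMinus set dd
    isDs      : IsDs set ds
    growth    : 2 ≤ n → Growth n dd ds

-- The construction starts in dimension two; below that the empty set is taken, without effect on
-- the asymptotics.
emptyExample : ∀ n → ¬ 2 ≤ n → Example n
emptyExample n n≱2 = record
  { set       = ∅
  ; digits    = []
  ; dd        = 0
  ; ds        = 0
  ; isDd      = (∅ , id , dissociated , refl) , λ D D⊆ _ → ⊆⇒length≤ (proj₂ D) D⊆
  ; isDdMinus = (∅ , (id , dissociated , λ _ D⊆ _ _ → D⊆) , refl) , λ _ _ → z≤n
  ; isDs      = (∅ , (id , λ _ ()) , refl) , λ _ _ → z≤n
  ; growth    = λ n≥2 → ⊥-elim (n≱2 n≥2)
  }
  where
  ∅ : FinSet n
  ∅ = [] , []
  dissociated : Dissociated ∅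
  dissociated [] _ = refl

largeExample : ∀ r → Example (suc (suc r))
largeExample r with largeFamily (suc r)
... | c , L , F , B = record
  { set       = A
  ; digits    = digits
  ; dd        = suc (suc r) ℕ.+ c
  ; ds        = proj₁ ds
  ; isDd      = isDd
  ; isDdMinus = isDdMinus
  ; isDs      = proj₁ (proj₂ ds)
  ; growth    = λ _ → record
    { L        = L
    ; 2^L≤n    = 2^L≤n
    ; n<2^1+L  = n<2^1+L
    -- Passing from `c` to `m + c` offsets the deficit `m` in `lower`, and in `dd-upper` it raises
    -- the constant 2 to 4.
    ; dd-lower = begin
        m ℕ.* L                          ≤⟨ ℕₚ.m≤m+n _ (L ℕ.+ 3) ⟩
        m ℕ.* L ℕ.+ (L ℕ.+ 3)            ≡⟨ sym (ℕₚ.+-assoc (m ℕ.* L) L 3) ⟩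
        m ℕ.* L ℕ.+ L ℕ.+ 3              ≤⟨ lower ⟩
        2 ℕ.* c ℕ.+ m                    ≤⟨ ℕₚ.m≤m+n _ m ⟩
        2 ℕ.* c ℕ.+ m ℕ.+ m              ≡⟨ eq₁ m c ⟩
        2 ℕ.* (m ℕ.+ c)                  ∎
    ; dd-upper = begin
        2 ℕ.* (m ℕ.+ c)                  ≡⟨ eq₂ m c ⟩
        2 ℕ.* c ℕ.+ m ℕ.* 2              ≤⟨ ℕₚ.+-monoˡ-≤ (m ℕ.* 2) upper ⟩
        m ℕ.* (L ℕ.+ 2) ℕ.+ m ℕ.* 2      ≡⟨ eq₃ m L ⟩
        m ℕ.* (L ℕ.+ 4)                  ∎
    ; ds-upper = proj₂ (proj₂ ds)
    }
  }
  where
  open Construction F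
  open FamilyBounds B
  open ℕₚ.≤-Reasoning
  m = suc (suc r)
  eq₁ : ∀ n c → 2 ℕ.* c ℕ.+ n ℕ.+ n ≡ 2 ℕ.* (n ℕ.+ c)
  eq₁ = ℕSolver.solve-∀
  eq₂ : ∀ n c → 2 ℕ.* (n ℕ.+ c) ≡ 2 ℕ.* c ℕ.+ n ℕ.* 2
  eq₂ = ℕSolver.solve-∀
  eq₃ : ∀ n L → n ℕ.* (L ℕ.+ 2) ℕ.+ n ℕ.* 2 ≡ n ℕ.* (L ℕ.+ 4)
  eq₃ = ℕSolver.solve-∀

example : ∀ n → Example n
example zero          = emptyExample 0 λ ()
example (suc zero)    = emptyExample 1 λ { (s≤s ()) }
example (suc (suc r)) = largeExample r

-- Powers of two and logarithmic error terms

4^≡2^2* : ∀ k → 4 ℕ.^ k ≡ 2 ℕ.^ (2 ℕ.* k)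
4^≡2^2* k = ℕₚ.^-*-assoc 2 2 k

2^-mono : ∀ {a b} → a ≤ b → 2 ℕ.^ a ≤ 2 ℕ.^ b
2^-mono = ℕₚ.^-monoʳ-≤ 2

≤2^⇒^≤2^* : ∀ {m} k a → m ≤ 2 ℕ.^ k → m ℕ.^ a ≤ 2 ℕ.^ (k ℕ.* a)
≤2^⇒^≤2^* k a m≤ = ℕₚ.≤-trans (ℕₚ.^-monoˡ-≤ a m≤) (ℕₚ.≤-reflexive (ℕₚ.^-*-assoc 2 k a))

2^≤⇒2^*≤^ : ∀ {m} k a → 2 ℕ.^ k ≤ m → 2 ℕ.^ (k ℕ.* a) ≤ m ℕ.^ a
2^≤⇒2^*≤^ k a ≤m = ℕₚ.≤-trans (ℕₚ.≤-reflexive (sym (ℕₚ.^-*-assoc 2 k a))) (ℕₚ.^-monoˡ-≤ a ≤m)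

n<2^n : ∀ n → n < 2 ℕ.^ n
n<2^n zero    = s≤s z≤n
n<2^n (suc n) = begin
  suc (suc n)         ≤⟨ s≤s (n<2^n n) ⟩
  suc (2 ℕ.^ n)       ≤⟨ ℕₚ.+-monoˡ-≤ (2 ℕ.^ n) (ℕₚ.≤-trans (s≤s z≤n) (n<2^n n)) ⟩
  2 ℕ.^ n ℕ.+ 2 ℕ.^ n ≡⟨ cong (2 ℕ.^ n ℕ.+_) (sym (ℕₚ.+-identityʳ _)) ⟩
  2 ℕ.^ suc n         ∎
  where open ℕₚ.≤-Reasoning

-- Holds at s = 2x+1 since 2^s = 2^x · 2 · 2^x ≥ x · 2 · (x+1), and passing from s to s+1 at most doubles the left side.
linear≤2^ : ∀ x d → x ℕ.* suc (suc (2 ℕ.* x) ℕ.+ d) ≤ 2 ℕ.^ (suc (2 ℕ.* x) ℕ.+ d)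
linear≤2^ x zero = begin
  x ℕ.* suc (suc (2 ℕ.* x) ℕ.+ 0)       ≡⟨ eq x ⟩
  2 ℕ.* (x ℕ.* suc x)                   ≤⟨ ℕₚ.*-monoʳ-≤ 2 (ℕₚ.*-mono-≤ (ℕₚ.<⇒≤ (n<2^n x)) (n<2^n x)) ⟩
  2 ℕ.* (2 ℕ.^ x ℕ.* 2 ℕ.^ x)           ≡⟨ cong (2 ℕ.*_) (sym (ℕₚ.^-distribˡ-+-* 2 x x)) ⟩
  2 ℕ.^ suc (x ℕ.+ x)                   ≡⟨ cong (2 ℕ.^_) (eq′ x) ⟩
  2 ℕ.^ (suc (2 ℕ.* x) ℕ.+ 0)           ∎
  where
  open ℕₚ.≤-Reasoning
  eq : ∀ x → x ℕ.* suc (suc (2 ℕ.* x) ℕ.+ 0) ≡ 2 ℕ.* (x ℕ.* suc x)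
  eq = ℕSolver.solve-∀
  eq′ : ∀ x → suc (x ℕ.+ x) ≡ suc (2 ℕ.* x) ℕ.+ 0
  eq′ = ℕSolver.solve-∀
linear≤2^ x (suc d) = begin
  x ℕ.* suc (suc (2 ℕ.* x) ℕ.+ suc d)         ≡⟨ eq x d ⟩
  x ℕ.+ x ℕ.* suc s                           ≤⟨ ℕₚ.+-monoˡ-≤ (x ℕ.* suc s) (ℕₚ.m≤m*n x (suc s)) ⟩
  x ℕ.* suc s ℕ.+ x ℕ.* suc s                 ≤⟨ ℕₚ.+-mono-≤ (linear≤2^ x d) (linear≤2^ x d) ⟩
  2 ℕ.^ s ℕ.+ 2 ℕ.^ s                         ≡⟨ cong (2 ℕ.^ s ℕ.+_) (sym (ℕₚ.+-identityʳ _)) ⟩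
  2 ℕ.^ suc s                                 ≡⟨ cong (2 ℕ.^_) (sym (ℕₚ.+-suc (suc (2 ℕ.* x)) d)) ⟩
  2 ℕ.^ (suc (2 ℕ.* x) ℕ.+ suc d)             ∎
  where
  open ℕₚ.≤-Reasoning
  s = suc (2 ℕ.* x) ℕ.+ d
  eq : ∀ x d → x ℕ.* suc (suc (2 ℕ.* x) ℕ.+ suc d) ≡ x ℕ.+ x ℕ.* suc (suc (2 ℕ.* x) ℕ.+ d)
  eq = ℕSolver.solve-∀

-- Prepares `ratio`, where `2 ^ s` bounds the factor `L + 4` in `dd`. The choice s = L / (4q) is
-- small against L / q, while `2 ^ s` still outgrows every linear function of L.
logarithm-small : ∀ q → 0 < q → ∃ λ N → ∀ L → N ≤ L →
  ∃ λ s → L ℕ.+ 4 ≤ 2 ℕ.^ s × q ℕ.* (2 ℕ.* s ℕ.+ 3) ≤ L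
logarithm-small q@(suc q-1) _ = s₀ ℕ.* w , λ L N≤L → go L (L / w)
    (subst (_≤ L / w) (m*n/n≡m s₀ w) (/-monoˡ-≤ w N≤L)) (m/n*n≤m L w)
    (ℕₚ.≤-trans (ℕₚ.≤-reflexive (m≡m%n+[m/n]*n L w)) (ℕₚ.+-monoˡ-≤ (L / w ℕ.* w) (ℕₚ.<⇒≤ (m%n<n L w))))
  where
  open ℕₚ.≤-Reasoning
  w x s₀ : ℕ
  w = 4 ℕ.* q
  -- Both `L` and 4 are at most `w * (s + 1)`, so `L + 4` is at most `x * (s + 1)`; from `s₀` on,
  -- `linear≤2^` applies to this `x`.
  x = 8 ℕ.* q
  s₀ = suc (2 ℕ.* x)
  eq₁ : ∀ q s → 4 ℕ.* q ℕ.+ s ℕ.* (4 ℕ.* q) ℕ.+ 4 ℕ.* q ℕ.* suc s ≡ 8 ℕ.* q ℕ.* suc s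
  eq₁ = ℕSolver.solve-∀
  eq₂ : ∀ q s → q ℕ.* (2 ℕ.* s ℕ.+ 2 ℕ.* s) ≡ s ℕ.* (4 ℕ.* q)
  eq₂ = ℕSolver.solve-∀
  go : ∀ L s → s₀ ≤ s → s ℕ.* w ≤ L → L ≤ w ℕ.+ s ℕ.* w →
    ∃ λ s → L ℕ.+ 4 ≤ 2 ℕ.^ s × q ℕ.* (2 ℕ.* s ℕ.+ 3) ≤ L
  go L s s₀≤s sw≤L L≤ = s , large , small
    where
    large : L ℕ.+ 4 ≤ 2 ℕ.^ s
    large = begin
      L ℕ.+ 4                              ≤⟨ ℕₚ.+-mono-≤ L≤ (ℕₚ.≤-trans (ℕₚ.m≤m*n 4 q) (ℕₚ.m≤m*n w (suc s))) ⟩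
      w ℕ.+ s ℕ.* w ℕ.+ w ℕ.* suc s        ≡⟨ eq₁ q s ⟩
      x ℕ.* suc s                          ≡⟨ cong (λ t → x ℕ.* suc t) (sym (ℕₚ.m+[n∸m]≡n s₀≤s)) ⟩
      x ℕ.* suc (s₀ ℕ.+ (s ℕ.∸ s₀))        ≤⟨ linear≤2^ x (s ℕ.∸ s₀) ⟩
      2 ℕ.^ (s₀ ℕ.+ (s ℕ.∸ s₀))            ≡⟨ cong (2 ℕ.^_) (ℕₚ.m+[n∸m]≡n s₀≤s) ⟩
      2 ℕ.^ s                              ∎
    2≤s : 2 ≤ s
    2≤s = ℕₚ.≤-trans (s≤s (ℕₚ.≤-trans (s≤s z≤n) (ℕₚ.≤-trans (ℕₚ.m≤m*n 8 q) (ℕₚ.m≤n*m x 2)))) s₀≤s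
    small : q ℕ.* (2 ℕ.* s ℕ.+ 3) ≤ L
    small = begin
      q ℕ.* (2 ℕ.* s ℕ.+ 3)                ≤⟨ ℕₚ.*-monoʳ-≤ q (ℕₚ.+-monoʳ-≤ (2 ℕ.* s) (ℕₚ.≤-trans (ℕₚ.n≤1+n 3) (ℕₚ.*-monoʳ-≤ 2 2≤s))) ⟩
      q ℕ.* (2 ℕ.* s ℕ.+ 2 ℕ.* s)          ≡⟨ eq₂ q s ⟩
      s ℕ.* w                              ≤⟨ sw≤L ⟩
      L                                    ∎

-- Comparison of binary exponents

module _ {n dd ds} (G : Growth n dd ds) (p q : ℕ) (p>0 : 0 < p) where
  open Growth G
  open ℕₚ.≤-Reasoning

  -- Turns largeness of n into largeness of its logarithm.
  exponent≤L : ∀ {N} → 2 ℕ.^ N ≤ n → N ≤ L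
  exponent≤L {N} 2^N≤n = ℕₚ.≮⇒≥ λ L<N → ℕₚ.<-irrefl refl
    (ℕₚ.<-≤-trans n<2^1+L (ℕₚ.≤-trans (2^-mono L<N) 2^N≤n))

  private
    -- Each error term below is bounded by `n * L` and then charged to the share `n * (p * L)`
    -- coming from ε = p/q.
    L≤pL : L ≤ p ℕ.* L
    L≤pL = ℕₚ.m≤n*m L p {{ℕ.>-nonZero p>0}}

  -- Rounding log₂ n up to `L + 1` costs `(q - p) * n` in the exponent, at most `n * L` once
  -- `q ≤ L`.
  within-lower : p < q → q ≤ L → n ℕ.^ ((q ℕ.∸ p) ℕ.* n) ≤ 4 ℕ.^ (q ℕ.* dd)
  within-lower p<q q≤L = begin
    n ℕ.^ (m ℕ.* n)                 ≤⟨ ≤2^⇒^≤2^* (suc L) (m ℕ.* n) (ℕₚ.<⇒≤ n<2^1+L) ⟩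
    2 ℕ.^ (suc L ℕ.* (m ℕ.* n))     ≤⟨ 2^-mono exponents ⟩
    2 ℕ.^ (2 ℕ.* (q ℕ.* dd))        ≡⟨ sym (4^≡2^2* (q ℕ.* dd)) ⟩
    4 ℕ.^ (q ℕ.* dd)                ∎
    where
    m = q ℕ.∸ p
    eq₁ : ∀ L m n → suc L ℕ.* (m ℕ.* n) ≡ n ℕ.* (m ℕ.+ m ℕ.* L)
    eq₁ = ℕSolver.solve-∀
    eq₂ : ∀ L m n p → n ℕ.* (p ℕ.* L ℕ.+ m ℕ.* L) ≡ (p ℕ.+ m) ℕ.* (n ℕ.* L)
    eq₂ = ℕSolver.solve-∀
    eq₃ : ∀ q dd → q ℕ.* (2 ℕ.* dd) ≡ 2 ℕ.* (q ℕ.* dd)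
    eq₃ = ℕSolver.solve-∀
    exponents : suc L ℕ.* (m ℕ.* n) ≤ 2 ℕ.* (q ℕ.* dd)
    exponents = begin
      suc L ℕ.* (m ℕ.* n)               ≡⟨ eq₁ L m n ⟩
      n ℕ.* (m ℕ.+ m ℕ.* L)             ≤⟨ ℕₚ.*-monoʳ-≤ n (ℕₚ.+-monoˡ-≤ (m ℕ.* L) (ℕₚ.≤-trans (ℕₚ.m∸n≤m q p) (ℕₚ.≤-trans q≤L L≤pL))) ⟩
      n ℕ.* (p ℕ.* L ℕ.+ m ℕ.* L)       ≡⟨ eq₂ L m n p ⟩
      (p ℕ.+ m) ℕ.* (n ℕ.* L)           ≡⟨ cong (ℕ._* (n ℕ.* L)) (ℕₚ.m+[n∸m]≡n (ℕₚ.<⇒≤ p<q)) ⟩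
      q ℕ.* (n ℕ.* L)                   ≤⟨ ℕₚ.*-monoʳ-≤ q dd-lower ⟩
      q ℕ.* (2 ℕ.* dd)                  ≡⟨ eq₃ q dd ⟩
      2 ℕ.* (q ℕ.* dd)                  ∎

  -- The excess `4 * q * n` due to `L + 4` is the term to be absorbed.
  within-upper : 4 ℕ.* q ≤ L → 4 ℕ.^ (q ℕ.* dd) ≤ n ℕ.^ ((q ℕ.+ p) ℕ.* n)
  within-upper 4q≤L = begin
    4 ℕ.^ (q ℕ.* dd)                     ≡⟨ 4^≡2^2* (q ℕ.* dd) ⟩
    2 ℕ.^ (2 ℕ.* (q ℕ.* dd))             ≤⟨ 2^-mono exponents ⟩
    2 ℕ.^ (L ℕ.* ((q ℕ.+ p) ℕ.* n))      ≤⟨ 2^≤⇒2^*≤^ L ((q ℕ.+ p) ℕ.* n) 2^L≤n ⟩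
    n ℕ.^ ((q ℕ.+ p) ℕ.* n)              ∎
    where
    eq₁ : ∀ q dd → 2 ℕ.* (q ℕ.* dd) ≡ q ℕ.* (2 ℕ.* dd)
    eq₁ = ℕSolver.solve-∀
    eq₂ : ∀ q n L → q ℕ.* (n ℕ.* (L ℕ.+ 4)) ≡ n ℕ.* (q ℕ.* L ℕ.+ 4 ℕ.* q)
    eq₂ = ℕSolver.solve-∀
    eq₃ : ∀ q n L p → n ℕ.* (q ℕ.* L ℕ.+ p ℕ.* L) ≡ L ℕ.* ((q ℕ.+ p) ℕ.* n)
    eq₃ = ℕSolver.solve-∀
    exponents : 2 ℕ.* (q ℕ.* dd) ≤ L ℕ.* ((q ℕ.+ p) ℕ.* n)
    exponents = begin
      2 ℕ.* (q ℕ.* dd)                   ≡⟨ eq₁ q dd ⟩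
      q ℕ.* (2 ℕ.* dd)                   ≤⟨ ℕₚ.*-monoʳ-≤ q dd-upper ⟩
      q ℕ.* (n ℕ.* (L ℕ.+ 4))            ≡⟨ eq₂ q n L ⟩
      n ℕ.* (q ℕ.* L ℕ.+ 4 ℕ.* q)        ≤⟨ ℕₚ.*-monoʳ-≤ n (ℕₚ.+-monoʳ-≤ (q ℕ.* L) (ℕₚ.≤-trans 4q≤L L≤pL)) ⟩
      n ℕ.* (q ℕ.* L ℕ.+ p ℕ.* L)        ≡⟨ eq₃ q n L p ⟩
      L ℕ.* ((q ℕ.+ p) ℕ.* n)            ∎

  -- Writing `dd` below `2 ^ (L + 1 + s)` and `ds` below `n + 1`, the exponent on the left has main
  -- term `q * n * L`, to be compared with `2 * dd`, which is at least `n * L`. The rest is `error`,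
  -- of relative order s / L.
  ratio : ∀ {s} → L ℕ.+ 4 ≤ 2 ℕ.^ s → q ℕ.* (2 ℕ.* s ℕ.+ 3) ≤ L →
    dd ℕ.^ (q ℕ.* ds) ≤ 4 ℕ.^ ((q ℕ.+ p) ℕ.* dd)
  ratio {s} L+4≤2^s small = begin
    dd ℕ.^ (q ℕ.* ds)                        ≤⟨ ≤2^⇒^≤2^* (suc L ℕ.+ s) (q ℕ.* ds) dd≤ ⟩
    2 ℕ.^ ((suc L ℕ.+ s) ℕ.* (q ℕ.* ds))     ≤⟨ 2^-mono exponents ⟩
    2 ℕ.^ (2 ℕ.* ((q ℕ.+ p) ℕ.* dd))         ≡⟨ sym (4^≡2^2* ((q ℕ.+ p) ℕ.* dd)) ⟩
    4 ℕ.^ ((q ℕ.+ p) ℕ.* dd)                 ∎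
    where
    dd≤ : dd ≤ 2 ℕ.^ (suc L ℕ.+ s)
    dd≤ = begin
      dd                                     ≤⟨ ℕₚ.m≤n*m dd 2 ⟩
      2 ℕ.* dd                               ≤⟨ dd-upper ⟩
      n ℕ.* (L ℕ.+ 4)                        ≤⟨ ℕₚ.*-mono-≤ (ℕₚ.<⇒≤ n<2^1+L) L+4≤2^s ⟩
      2 ℕ.^ suc L ℕ.* 2 ℕ.^ s                ≡⟨ sym (ℕₚ.^-distribˡ-+-* 2 (suc L) s) ⟩
      2 ℕ.^ (suc L ℕ.+ s)                    ∎
    L≤n : L ≤ n
    L≤n = ℕₚ.≤-trans (ℕₚ.<⇒≤ (n<2^n L)) 2^L≤n
    1≤n : 1 ≤ n
    1≤n = ℕₚ.≤-trans (ℕₚ.≤-trans (s≤s z≤n) (n<2^n L)) 2^L≤n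
    eq₁ : ∀ L s q n → (suc L ℕ.+ s) ℕ.* (q ℕ.* suc n) ≡ q ℕ.* (n ℕ.* L) ℕ.+ (q ℕ.* L ℕ.+ q ℕ.* suc s ℕ.* (n ℕ.+ 1))
    eq₁ = ℕSolver.solve-∀
    eq₂ : ∀ q s n → q ℕ.* n ℕ.+ q ℕ.* suc s ℕ.* (n ℕ.+ n) ≡ n ℕ.* (q ℕ.* (2 ℕ.* s ℕ.+ 3))
    eq₂ = ℕSolver.solve-∀
    eq₃ : ∀ q n L p → q ℕ.* (n ℕ.* L) ℕ.+ n ℕ.* (p ℕ.* L) ≡ (q ℕ.+ p) ℕ.* (n ℕ.* L)
    eq₃ = ℕSolver.solve-∀
    eq₄ : ∀ m dd → m ℕ.* (2 ℕ.* dd) ≡ 2 ℕ.* (m ℕ.* dd)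
    eq₄ = ℕSolver.solve-∀
    error : q ℕ.* L ℕ.+ q ℕ.* suc s ℕ.* (n ℕ.+ 1) ≤ n ℕ.* (p ℕ.* L)
    error = begin
      q ℕ.* L ℕ.+ q ℕ.* suc s ℕ.* (n ℕ.+ 1)  ≤⟨ ℕₚ.+-mono-≤ (ℕₚ.*-monoʳ-≤ q L≤n) (ℕₚ.*-monoʳ-≤ (q ℕ.* suc s) (ℕₚ.+-monoʳ-≤ n 1≤n)) ⟩
      q ℕ.* n ℕ.+ q ℕ.* suc s ℕ.* (n ℕ.+ n)  ≡⟨ eq₂ q s n ⟩
      n ℕ.* (q ℕ.* (2 ℕ.* s ℕ.+ 3))          ≤⟨ ℕₚ.*-monoʳ-≤ n (ℕₚ.≤-trans small L≤pL) ⟩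
      n ℕ.* (p ℕ.* L)                        ∎
    exponents : (suc L ℕ.+ s) ℕ.* (q ℕ.* ds) ≤ 2 ℕ.* ((q ℕ.+ p) ℕ.* dd)
    exponents = begin
      (suc L ℕ.+ s) ℕ.* (q ℕ.* ds)           ≤⟨ ℕₚ.*-monoʳ-≤ (suc L ℕ.+ s) (ℕₚ.*-monoʳ-≤ q ds-upper) ⟩
      (suc L ℕ.+ s) ℕ.* (q ℕ.* suc n)        ≡⟨ eq₁ L s q n ⟩
      q ℕ.* (n ℕ.* L) ℕ.+ (q ℕ.* L ℕ.+ q ℕ.* suc s ℕ.* (n ℕ.+ 1)) ≤⟨ ℕₚ.+-monoʳ-≤ (q ℕ.* (n ℕ.* L)) error ⟩
      q ℕ.* (n ℕ.* L) ℕ.+ n ℕ.* (p ℕ.* L)    ≡⟨ eq₃ q n L p ⟩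
      (q ℕ.+ p) ℕ.* (n ℕ.* L)                ≤⟨ ℕₚ.*-monoʳ-≤ (q ℕ.+ p) dd-lower ⟩
      (q ℕ.+ p) ℕ.* (2 ℕ.* dd)               ≡⟨ eq₄ (q ℕ.+ p) dd ⟩
      2 ℕ.* ((q ℕ.+ p) ℕ.* dd)               ∎

module _ (dd ds : ℕ → ℕ) (growth : ∀ n → 2 ≤ n → Growth n (dd n) (ds n)) where

  private
    2≤2^ : ∀ {N n} → 1 ≤ N → 2 ℕ.^ N ≤ n → 2 ≤ n
    2≤2^ 1≤N = ℕₚ.≤-trans (2^-mono 1≤N)

  eventuallyWithin : EventuallyWithin dd
  -- This threshold gives `4 * q ≤ L`, enough for both inequalities, and also `2 ≤ n`.
  eventuallyWithin p q p>0 p<q = 2 ℕ.^ (4 ℕ.* q) , λ n N≤n →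
    let G = growth n (2≤2^ 1≤4q N≤n)
        4q≤L = exponent≤L G p q p>0 N≤n
    in within-lower G p q p>0 p<q (ℕₚ.≤-trans (ℕₚ.m≤n*m q 4) 4q≤L) , within-upper G p q p>0 4q≤L
    where
    1≤4q : 1 ≤ 4 ℕ.* q
    1≤4q = ℕₚ.≤-trans (ℕₚ.≤-trans p>0 (ℕₚ.<⇒≤ p<q)) (ℕₚ.m≤n*m q 4)

  eventuallyRatio : EventuallyRatio dd dd ds
  eventuallyRatio p q p>0 p<q with logarithm-small q (ℕₚ.<-trans p>0 p<q)
  -- The successor guarantees `2 ≤ n` even when `N` is 0.
  ... | N , slog = 2 ℕ.^ suc N , λ n N≤n →
    let G = growth n (2≤2^ {suc N} (s≤s z≤n) N≤n)
        s , L+4≤2^s , small = slog (Growth.L G) (ℕₚ.<⇒≤ (exponent≤L G p q p>0 N≤n))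
    in ratio G p q p>0 {s} L+4≤2^s small

theorem1p5 : Σ ((n : ℕ) → FinSet n) λ A →
    (∀ n → In012 (A n)) ×
    ∃ λ dd → ∃ λ dm → ∃ λ ds →
    (∀ n → IsDd (A n) (dd n)) × (∀ n → IsDdMinus (A n) (dm n)) × (∀ n → IsDs (A n) (ds n)) ×
    EventuallyWithin dd × EventuallyRatio dd dm ds
theorem1p5 =
  (λ n → set (example n)) , (λ n → digits (example n)) ,
  -- The same function serves for d_d and d_d^-, since all maximal dissociated subsets have equal
  -- size.
  dd′ , dd′ , ds′ ,
  (λ n → isDd (example n)) , (λ n → isDdMinus (example n)) , (λ n → isDs (example n)) ,
  eventuallyWithin dd′ ds′ (λ n → growth (example n)) , eventuallyRatio dd′ ds′ (λ n → growth (example n))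
  where
  open Example
  dd′ ds′ : ℕ → ℕ
  dd′ n = dd (example n)
  ds′ n = ds (example n)
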